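{- For all positive integers $m,n,j,k$, $$ \begin{aligned} &\zeta(m+1,\{1\}^{j-1})\,\zeta(n+1,\{1\}^{k-1})\\ &=\sum_{\substack{0\le n_1\le n\\ j_1+j_2=j,\ j_i\ge 0\\ |\alpha|=n-n_1+j_1+1}}\binom{m-1+n_1}{m-1}\binom{j_2+k-1}{k-1}\,\zeta\big(\alpha_1+m+n_1,\alpha_2,\ldots,\alpha_{j_1},\alpha_{j_1+1},\{1\}^{j_2+k-1}\big)\\ &\quad+\sum_{\substack{0\le t\le k-1\\ m_1+m_2=m-1,\ m_i\ge 0\\ |\beta|=m_2+k-t+1}}\binom{m_1+n-1}{n-1}\binom{j+t}{j}\,\zeta\big(\beta_1+m_1+n,\beta_2,\ldots,\beta_{k-t},\beta_{k-t+1}+1,\{1\}^{j+t-1}\big), \end{aligned} $$ where in the first sum $(n_1,j_1,j_2)$ ranges over the indicated integers and, for each of them, $\alpha=(\alpha_1,\ldots,\alpha_{j_1+1})$ ranges over all tuples of integers $\alpha_i\ge 1$ with $|\alpha|:=\alpha_1+\cdots+\alpha_{j_1+1}=n-n_1+j_1+1$; and in the second sum $(t,m_1,m_2)$ ranges over the indicated integers and, for each of them, $\beta=(\beta_1,\ldots,\beta_{k-t+1})$ ranges over all tuples of integers $\beta_i\ge 1$ with $|\beta|:=\beta_1+\cdots+\beta_{k-t+1}=m_2+k-t+1$.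
   Context: For positive integers $s_1,\ldots,s_r$ with $s_1\ge 2$, the multiple zeta value is the real number $$\zeta(s_1,\ldots,s_r)=\sum_{n_1>n_2>\cdots>n_r\ge 1}\frac{1}{n_1^{s_1}\cdots n_r^{s_r}}.$$ $\{1\}^p$ denotes the string $1,\ldots,1$ with $p$ terms (the empty string if $p=0$). Convention: when $j_1=0$, the string $\alpha_1+m+n_1,\alpha_2,\ldots,\alpha_{j_1},\alpha_{j_1+1}$ means the single entry $\alpha_1+m+n_1$. When $k-t=1$, the string $\beta_1+m_1+n,\beta_2,\ldots,\beta_{k-t},\beta_{k-t+1}+1$ means $\beta_1+m_1+n,\ \beta_2+1$. -}

module Defs where

open import Data.Integer.Base as ℤ using (1ℤ; +_; +[1+_]; -[1+_])
import Data.Integer.Properties as ℤ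
open import Data.List.Base using (List; []; _∷_; foldr; map; concatMap; upTo)
open import Data.Nat.Base as ℕ using (ℕ; zero; suc; NonTrivial)
import Data.Nat.Properties as ℕ
open import Data.Product.Base using (∃; _×_; _,_; proj₁; proj₂)
open import Data.Rational.Base hiding (_≃_)
open import Data.Rational.Properties
open import Data.Rational.Solver using (module +-*-Solver)
import Data.Rational.Unnormalised.Base as ℚᵘ
import Data.Rational.Unnormalised.Properties as ℚᵘ
open import Data.Sum.Base using (inj₁; inj₂)
open import Data.Vec.Base as Vec using (Vec)
open import Relation.Binary.PropositionalEquality using (_≡_; refl; sym; trans; cong; cong₂; subst)

open +-*-Solver using (solve; _:=_; _:+_; _:*_; _:-_; :-_; con)

0<½* : ∀ {ε} → 0ℚ < ε → 0ℚ < ½ * ε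
0<½* {ε} 0<ε = subst (_< ½ * ε) (*-zeroʳ ½) (*-monoʳ-<-pos ½ 0<ε)

½+½ : ∀ ε → ½ * ε + ½ * ε ≡ ε
½+½ ε = trans (sym (*-distribʳ-+ ε ½ ½)) (*-identityˡ ε)

*-mono-≤ : ∀ {p q r s} → 0ℚ ≤ r → 0ℚ ≤ q → p ≤ q → r ≤ s → p * r ≤ q * s
*-mono-≤ {p} {q} {r} {s} 0≤r 0≤q p≤q r≤s = ≤-trans
  (*-monoʳ-≤-nonNeg r {{nonNegative 0≤r}} p≤q)
  (*-monoˡ-≤-nonNeg q {{nonNegative 0≤q}} r≤s)

0≤+ : ∀ {p q} → 0ℚ ≤ p → 0ℚ ≤ q → 0ℚ ≤ p + q
0≤+ = +-mono-≤

0≤* : ∀ {p q} → 0ℚ ≤ p → 0ℚ ≤ q → 0ℚ ≤ p * q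
0≤* {p} {q} 0≤p 0≤q = subst (_≤ p * q) (*-zeroʳ p) (*-monoˡ-≤-nonNeg p {{nonNegative 0≤p}} 0≤q)

p≤p+q : ∀ p {q} → 0ℚ ≤ q → p ≤ p + q
p≤p+q p {q} 0≤q = subst (_≤ p + q) (+-identityʳ p) (+-monoʳ-≤ p 0≤q)

p≤q+p : ∀ p {q} → 0ℚ ≤ q → p ≤ q + p
p≤q+p p {q} 0≤q = subst (p ≤_) (+-comm p q) (p≤p+q p 0≤q)

∣p-p∣≡0 : ∀ p → ∣ p - p ∣ ≡ 0ℚ
∣p-p∣≡0 p = cong ∣_∣ (+-inverseʳ p)

-- Two points of [a , a + b] are at distance at most b.
∣-∣-interval : ∀ {a b p q} → a ≤ p → p ≤ a + b → a ≤ q → q ≤ a + b → ∣ p - q ∣ ≤ b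
∣-∣-interval {a} {b} {p} {q} a≤p p≤a+b a≤q q≤a+b with ∣p∣≡p∨∣p∣≡-p (p - q)
... | inj₁ eq = subst (_≤ b) (sym eq) (subst (p - q ≤_)
        (solve 2 (λ a b → (a :+ b) :- a := b) refl a b) (+-mono-≤ p≤a+b (neg-antimono-≤ a≤q)))
... | inj₂ eq = subst (_≤ b) (sym (trans eq (solve 2 (λ p q → :- (p :- q) := q :- p) refl p q)))
        (subst (q - p ≤_)
          (solve 2 (λ a b → (a :+ b) :- a := b) refl a b) (+-mono-≤ q≤a+b (neg-antimono-≤ a≤p)))

-- A real number is a Cauchy sequence of rationals; sequences whose
-- difference tends to 0 represent the same real, so equality is _≈_.
record ℝ : Set where
  field
    seq    : ℕ → ℚ
    cauchy : ∀ ε → 0ℚ < ε →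
             ∃ λ N → ∀ p q → N ℕ.≤ p → N ℕ.≤ q → ∣ seq p - seq q ∣ < ε

open ℝ public

infix  4 _≈_
infixl 6 _+ℝ_
infixl 7 _*ℝ_

_≈_ : ℝ → ℝ → Set
x ≈ y = ∀ ε → 0ℚ < ε → ∃ λ N → ∀ n → N ℕ.≤ n → ∣ seq x n - seq y n ∣ < ε

fromℚ : ℚ → ℝ
fromℚ r .seq _ = r
fromℚ r .cauchy ε 0<ε = 0 , λ _ _ _ _ → subst (_< ε) (sym (∣p-p∣≡0 r)) 0<ε

fromℕ : ℕ → ℝ
fromℕ n = fromℚ (+ n / 1)

_+ℝ_ : ℝ → ℝ → ℝ
(x +ℝ y) .seq n = seq x n + seq y n
(x +ℝ y) .cauchy ε 0<ε
  with N₁ , h₁ ← cauchy x (½ * ε) (0<½* 0<ε)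
  with N₂ , h₂ ← cauchy y (½ * ε) (0<½* 0<ε) =
  N₁ ℕ.⊔ N₂ , λ p q N≤p N≤q →
    subst (_ <_) (½+½ ε) (≤-<-trans
      (subst (λ d → ∣ d ∣ ≤ ∣ seq x p - seq x q ∣ + ∣ seq y p - seq y q ∣)
        (solve 4 (λ a b c d → (a :- b) :+ (c :- d) := (a :+ c) :- (b :+ d)) refl
          (seq x p) (seq x q) (seq y p) (seq y q))
        (∣p+q∣≤∣p∣+∣q∣ (seq x p - seq x q) (seq y p - seq y q)))
      (+-mono-<
        (h₁ p q (ℕ.m⊔n≤o⇒m≤o N₁ N₂ N≤p) (ℕ.m⊔n≤o⇒m≤o N₁ N₂ N≤q))
        (h₂ p q (ℕ.m⊔n≤o⇒n≤o N₁ N₂ N≤p) (ℕ.m⊔n≤o⇒n≤o N₁ N₂ N≤q))))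

module _ (f : ℕ → ℚ) where

  ∑∣_∣ : ℕ → ℚ
  ∑∣_∣ zero    = ∣ f 0 ∣
  ∑∣_∣ (suc n) = ∑∣_∣ n + ∣ f (suc n) ∣

  0≤∑∣∣ : ∀ n → 0ℚ ≤ ∑∣_∣ n
  0≤∑∣∣ zero    = 0≤∣p∣ (f 0)
  0≤∑∣∣ (suc n) = 0≤+ (0≤∑∣∣ n) (0≤∣p∣ (f (suc n)))

  ∣f∣≤∑∣∣ : ∀ {i n} → i ℕ.≤′ n → ∣ f i ∣ ≤ ∑∣_∣ n
  ∣f∣≤∑∣∣ {zero}  (ℕ.≤′-reflexive refl) = ≤-refl
  ∣f∣≤∑∣∣ {suc i} (ℕ.≤′-reflexive refl) = p≤q+p _ (0≤∑∣∣ i)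
  ∣f∣≤∑∣∣ {i} (ℕ.≤′-step {n} i≤n) = ≤-trans (∣f∣≤∑∣∣ i≤n) (p≤p+q _ (0≤∣p∣ (f (suc n))))

bounded : ∀ x → ∃ λ b → 0ℚ < b × (∀ n → ∣ seq x n ∣ ≤ b)
bounded x with N , h ← cauchy x 1ℚ (positive⁻¹ 1ℚ) =
  ∑∣_∣ (seq x) N + 1ℚ , +-mono-≤-< (0≤∑∣∣ (seq x) N) (positive⁻¹ 1ℚ) , bound
  where
  bound : ∀ n → ∣ seq x n ∣ ≤ ∑∣_∣ (seq x) N + 1ℚ
  bound n with ℕ.≤-total n N
  ... | inj₁ n≤N = ≤-trans (∣f∣≤∑∣∣ (seq x) (ℕ.≤⇒≤′ n≤N)) (p≤p+q _ (nonNegative⁻¹ 1ℚ))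
  ... | inj₂ N≤n = ≤-trans
    (subst (λ d → ∣ d ∣ ≤ ∣ seq x N ∣ + ∣ seq x n - seq x N ∣)
      (solve 2 (λ a b → b :+ (a :- b) := a) refl (seq x n) (seq x N))
      (∣p+q∣≤∣p∣+∣q∣ (seq x N) (seq x n - seq x N)))
    (+-mono-≤ (∣f∣≤∑∣∣ (seq x) (ℕ.≤⇒≤′ ℕ.≤-refl)) (<⇒≤ (h n N N≤n ℕ.≤-refl)))

0<÷ : ∀ {p q} → 0ℚ < p → (0<q : 0ℚ < q) → 0ℚ < (p ÷ q) {{>-nonZero 0<q}}
0<÷ {p} {q} 0<p 0<q = positive⁻¹ (p * r) {{pos*pos⇒pos p {{positive 0<p}} r {{r>0}}}}
  where
  r = (1/ q) {{>-nonZero 0<q}}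
  r>0 : Positive r
  r>0 = 1/pos⇒pos q {{positive 0<q}}

÷-* : ∀ p {q} (0<q : 0ℚ < q) → (p ÷ q) {{>-nonZero 0<q}} * q ≡ p
÷-* p {q} 0<q = trans (*-assoc p _ q)
  (trans (cong (p *_) (*-inverseˡ q {{>-nonZero 0<q}})) (*-identityʳ p))

quotient : ∀ {p q} → 0ℚ < p → 0ℚ < q → ∃ λ r → 0ℚ < r × r * q ≡ p
quotient {p} {q} 0<p 0<q = (p ÷ q) {{>-nonZero 0<q}} , 0<÷ 0<p 0<q , ÷-* p 0<q

_*ℝ_ : ℝ → ℝ → ℝ
(x *ℝ y) .seq n = seq x n * seq y n
(x *ℝ y) .cauchy ε 0<ε
  with a , 0<a , ∣x∣≤a ← bounded x
  with b , 0<b , ∣y∣≤b ← bounded y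
  with 0<b+a ← +-mono-< 0<b 0<a
  with δ , 0<δ , δ[b+a]≡ε ← quotient 0<ε 0<b+a
  with N₁ , h₁ ← cauchy x δ 0<δ
  with N₂ , h₂ ← cauchy y δ 0<δ =
  N₁ ℕ.⊔ N₂ , λ p q N≤p N≤q →
    let Δx = seq x p - seq x q
        Δy = seq y p - seq y q
    in subst (_ <_) (trans (sym (*-distribˡ-+ δ b a)) δ[b+a]≡ε) (≤-<-trans
      (subst (λ d → ∣ d ∣ ≤ ∣ Δx ∣ * ∣ seq y p ∣ + ∣ Δy ∣ * ∣ seq x q ∣)
        (solve 4 (λ a b c d → (a :- b) :* c :+ (c :- d) :* b := a :* c :- b :* d) refl
          (seq x p) (seq x q) (seq y p) (seq y q))
        (subst (∣ Δx * seq y p + Δy * seq x q ∣ ≤_)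
          (cong₂ _+_ (∣p*q∣≡∣p∣*∣q∣ Δx (seq y p)) (∣p*q∣≡∣p∣*∣q∣ Δy (seq x q)))
          (∣p+q∣≤∣p∣+∣q∣ (Δx * seq y p) (Δy * seq x q))))
      (+-mono-<
        (≤-<-trans (*-monoˡ-≤-nonNeg ∣ Δx ∣ {{∣-∣-nonNeg Δx}} (∣y∣≤b p))
          (*-monoˡ-<-pos b {{positive 0<b}}
            (h₁ p q (ℕ.m⊔n≤o⇒m≤o N₁ N₂ N≤p) (ℕ.m⊔n≤o⇒m≤o N₁ N₂ N≤q))))
        (≤-<-trans (*-monoˡ-≤-nonNeg ∣ Δy ∣ {{∣-∣-nonNeg Δy}} (∣x∣≤a q))
          (*-monoˡ-<-pos a {{positive 0<a}}
            (h₂ p q (ℕ.m⊔n≤o⇒n≤o N₁ N₂ N≤p) (ℕ.m⊔n≤o⇒n≤o N₁ N₂ N≤q))))))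

∑ : {A : Set} → List A → (A → ℝ) → ℝ
∑ xs f = foldr (λ x s → f x +ℝ s) (fromℕ 0) xs

record ℕ⁺ : Set where
  constructor pos⁺
  field
    val       : ℕ
    .{{val≢0}} : ℕ.NonZero val

open ℕ⁺ public using (val)

1⁺ : ℕ⁺
1⁺ = pos⁺ 1

suc⁺ : ℕ⁺ → ℕ⁺
suc⁺ p = pos⁺ (suc (val p))

antidiagonal : ℕ → List (ℕ × ℕ)
antidiagonal n = map (λ i → i , n ℕ.∸ i) (upTo (suc n))

-- Each d-tuple of positive integers with sum n occurs exactly once.
tuples : (d n : ℕ) → List (Vec ℕ⁺ d)
tuples zero    zero    = Vec.[] ∷ []
tuples zero    (suc _) = []
tuples (suc d) n       =
  concatMap (λ i → map (pos⁺ (suc i) Vec.∷_) (tuples d (n ℕ.∸ suc i))) (upTo n)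

incrementLast : ∀ {d} → Vec ℕ⁺ d → Vec ℕ⁺ d
incrementLast Vec.[]                 = Vec.[]
incrementLast (p Vec.∷ Vec.[])       = suc⁺ p Vec.∷ Vec.[]
incrementLast (p Vec.∷ ps@(_ Vec.∷ _)) = p Vec.∷ incrementLast ps

m+1-nonTrivial : ∀ m → .{{_ : ℕ.NonZero m}} → NonTrivial (m ℕ.+ 1)
m+1-nonTrivial (suc m) = ℕ.n>1⇒nonTrivial (ℕ.s≤s (ℕ.m≤n+m 1 m))

p+m+n-nonTrivialᵐ : ∀ p m n → .{{_ : ℕ.NonZero m}} → NonTrivial (val p ℕ.+ m ℕ.+ n)
p+m+n-nonTrivialᵐ (pos⁺ (suc p)) (suc m) n =
  ℕ.n>1⇒nonTrivial (ℕ.m≤n⇒m≤n+o n (ℕ.s≤s (ℕ.m≤n⇒m≤o+n p (ℕ.s≤s ℕ.z≤n))))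

p+m+n-nonTrivialⁿ : ∀ p m n → .{{_ : ℕ.NonZero n}} → NonTrivial (val p ℕ.+ m ℕ.+ n)
p+m+n-nonTrivialⁿ (pos⁺ (suc p)) m (suc n) =
  ℕ.n>1⇒nonTrivial (ℕ.s≤s (ℕ.m≤n⇒m≤o+n (p ℕ.+ m) (ℕ.s≤s ℕ.z≤n)))

1/[1+_]^_ : ℕ → ℕ → ℚ
1/[1+ n ]^ s = (1ℤ / (suc n ℕ.^ s)) {{ℕ.m^n≢0 (suc n) s}}

-- H (s₁ ∷ … ∷ sᵣ) N is the sum of 1 / (n₁^s₁ ⋯ nᵣ^sᵣ) over
-- N ≥ n₁ > ⋯ > nᵣ ≥ 1, split according to whether n₁ = N.
H : List ℕ⁺ → ℕ → ℚ
H []       _       = 1ℚ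
H (s ∷ ss) zero    = 0ℚ
H (s ∷ ss) (suc N) = H (s ∷ ss) N + 1/[1+ N ]^ val s * H ss N

toℚᵘ-/ : ∀ i n → toℚᵘ (i / suc n) ℚᵘ.≃ ℚᵘ.mkℚᵘ i n
toℚᵘ-/ i n = toℚᵘ-fromℚᵘ (ℚᵘ.mkℚᵘ i n)

1/-antimono-≤ : ∀ {a b} .{{_ : ℕ.NonZero a}} .{{_ : ℕ.NonZero b}} → a ℕ.≤ b → 1ℤ / b ≤ 1ℤ / a
1/-antimono-≤ {suc a} {suc b} a≤b = toℚᵘ-cancel-≤
  (ℚᵘ.≤-respˡ-≃ (ℚᵘ.≃-sym (toℚᵘ-/ 1ℤ b)) (ℚᵘ.≤-respʳ-≃ (ℚᵘ.≃-sym (toℚᵘ-/ 1ℤ a))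
    (ℚᵘ.*≤* (ℤ.*-monoˡ-≤-nonNeg 1ℤ (ℤ.+≤+ a≤b)))))

1/-*-homo : ∀ a b .{{_ : ℕ.NonZero a}} .{{_ : ℕ.NonZero b}} .{{_ : ℕ.NonZero (a ℕ.* b)}} →
            1ℤ / (a ℕ.* b) ≡ (1ℤ / a) * (1ℤ / b)
1/-*-homo (suc a) (suc b) = toℚᵘ-injective (ℚᵘ.≃-trans
  (toℚᵘ-/ 1ℤ (b ℕ.+ a ℕ.* suc b))
  (ℚᵘ.≃-sym (ℚᵘ.≃-trans (toℚᵘ-homo-* (1ℤ / suc a) (1ℤ / suc b)) (ℚᵘ.*-cong (toℚᵘ-/ 1ℤ a) (toℚᵘ-/ 1ℤ b)))))

-- Opaque only so that unification does not unfold the gcd computations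
-- inside _/_.
opaque

  inv : ℕ → ℚ
  inv n = 1ℤ / suc n

  0≤inv : ∀ n → 0ℚ ≤ inv n
  0≤inv n = nonNegative⁻¹ (inv n) {{normalize-nonNeg 1 (suc n)}}

  inv≡ : ∀ n → inv n ≡ 1ℤ / suc n
  inv≡ n = refl

  0<inv : ∀ n → Positive (inv n)
  0<inv n = normalize-pos 1 (suc n)

  inv-antimono-≤ : ∀ {m n} → m ℕ.≤ n → inv n ≤ inv m
  inv-antimono-≤ m≤n = 1/-antimono-≤ (ℕ.s≤s m≤n)

  1/^≤inv : ∀ n s → .{{ℕ.NonZero s}} → 1/[1+ n ]^ s ≤ inv n
  1/^≤inv n s@(suc s′) = 1/-antimono-≤ {{_}} {{ℕ.m^n≢0 (suc n) s}}
    (ℕ.m≤m*n (suc n) (suc n ℕ.^ s′) {{ℕ.m^n≢0 (suc n) s′}})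

  1/^≤inv² : ∀ n s → .{{NonTrivial s}} → 1/[1+ n ]^ s ≤ inv n * inv n
  1/^≤inv² n (suc s@(suc _)) = subst (_≤ inv n * inv n)
    (sym (1/-*-homo (suc n) (suc n ℕ.^ s) {{_}} {{ℕ.m^n≢0 (suc n) s}} {{ℕ.m^n≢0 (suc n) (suc s)}}))
    (*-monoˡ-≤-nonNeg (inv n) {{nonNegative (0≤inv n)}} (1/^≤inv n s))

  ι : ℕ → ℚ
  ι n = + n / 1

  0≤ι : ∀ n → 0ℚ ≤ ι n
  0≤ι n = nonNegative⁻¹ (ι n) {{normalize-nonNeg n 1}}

  ι-suc : ∀ n → ι (suc n) ≡ 1ℚ + ι n
  ι-suc n = toℚᵘ-injective (ℚᵘ.≃-trans (toℚᵘ-/ (+ suc n) 0) (ℚᵘ.≃-sym (ℚᵘ.≃-trans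
    (toℚᵘ-homo-+ 1ℚ (ι n)) (ℚᵘ.≃-trans (ℚᵘ.+-congʳ (toℚᵘ 1ℚ) (toℚᵘ-/ (+ n) 0))
    (ℚᵘ.*≡* (cong (λ z → (1ℤ ℤ.+ z) ℤ.* 1ℤ) (ℤ.*-identityʳ (+ n))))))))

  ι-mono-≤ : ∀ {m n} → m ℕ.≤ n → ι m ≤ ι n
  ι-mono-≤ {m} {n} m≤n = toℚᵘ-cancel-≤
    (ℚᵘ.≤-respˡ-≃ (ℚᵘ.≃-sym (toℚᵘ-/ (+ m) 0)) (ℚᵘ.≤-respʳ-≃ (ℚᵘ.≃-sym (toℚᵘ-/ (+ n) 0))
      (ℚᵘ.*≤* (ℤ.*-monoʳ-≤-nonNeg 1ℤ (ℤ.+≤+ m≤n)))))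

  inv*ι : ∀ n → inv n * ι (suc n) ≡ 1ℚ
  inv*ι n = toℚᵘ-injective (ℚᵘ.≃-trans (toℚᵘ-homo-* (inv n) (ι (suc n)))
    (ℚᵘ.≃-trans (ℚᵘ.*-cong (toℚᵘ-/ 1ℤ n) (toℚᵘ-/ (+ suc n) 0))
    (ℚᵘ.*≡* (trans (ℤ.*-identityʳ (1ℤ ℤ.* + suc n)) (cong (λ z → 1ℤ ℤ.* + z) (sym (ℕ.*-identityʳ (suc n))))))))

  archimedean : ∀ r → ∃ λ n → r < ι (suc n)
  archimedean r@(mkℚ i d _) = ℤ.∣ i ∣ , toℚᵘ-cancel-<
    (ℚᵘ.<-respʳ-≃ (ℚᵘ.≃-sym (toℚᵘ-/ (+ suc ℤ.∣ i ∣) 0)) (ℚᵘ.*<* (bound i)))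
    where
    bound : ∀ i → i ℤ.* 1ℤ ℤ.< + suc ℤ.∣ i ∣ ℤ.* + suc d
    bound (+ n)    = subst (ℤ._< + (suc n ℕ.* suc d)) (sym (ℤ.*-identityʳ (+ n)))
                       (ℤ.+<+ (ℕ.m≤m*n (suc n) (suc d)))
    bound -[1+ n ] = ℤ.-<+

-- C / (i + 1) < δ for large i.
*inv-small : ∀ C δ → 0ℚ < δ → ∃ λ K → ∀ i → K ℕ.≤ i → C * inv i < δ
*inv-small C δ 0<δ
  with K , r<K ← archimedean ((C ÷ δ) {{>-nonZero 0<δ}}) = K , λ i K≤i →
  subst (_< δ) (cong (_* inv i) (÷-* C 0<δ))
    (subst (r * δ * inv i <_) (trans (*-assoc δ _ (inv i))
        (trans (cong (δ *_) (trans (*-comm _ (inv i)) (inv*ι i))) (*-identityʳ δ)))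
      (*-monoˡ-<-pos (inv i) {{0<inv i}}
        (subst (_< δ * ι (suc i)) (*-comm δ r)
          (*-monoʳ-<-pos δ {{positive 0<δ}} (<-≤-trans r<K (ι-mono-≤ (ℕ.s≤s K≤i)))))))
  where r = (C ÷ δ) {{>-nonZero 0<δ}}

0≤1/^ : ∀ n s → 0ℚ ≤ 1/[1+ n ]^ s
0≤1/^ n s = nonNegative⁻¹ _ {{normalize-nonNeg 1 (suc n ℕ.^ s) {{ℕ.m^n≢0 (suc n) s}}}}

0≤H : ∀ ss N → 0ℚ ≤ H ss N
0≤H []       N       = nonNegative⁻¹ 1ℚ
0≤H (s ∷ ss) zero    = ≤-refl
0≤H (s ∷ ss) (suc N) = 0≤+ (0≤H (s ∷ ss) N) (0≤* (0≤1/^ N (val s)) (0≤H ss N))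

H-mono′ : ∀ ss {M N} → M ℕ.≤′ N → H ss M ≤ H ss N
H-mono′ ss       (ℕ.≤′-reflexive refl) = ≤-refl
H-mono′ []       (ℕ.≤′-step M≤N)       = ≤-refl
H-mono′ (s ∷ ss) (ℕ.≤′-step {N} M≤N)   =
  ≤-trans (H-mono′ (s ∷ ss) M≤N) (p≤p+q _ (0≤* (0≤1/^ N (val s)) (0≤H ss N)))

H-mono : ∀ ss {M N} → M ℕ.≤ N → H ss M ≤ H ss N
H-mono ss M≤N = H-mono′ ss (ℕ.≤⇒≤′ M≤N)

H-step≤ : ∀ s ss N → H (s ∷ ss) (suc N) ≤ H (s ∷ ss) N + inv N * H ss N
H-step≤ (pos⁺ s) ss N = +-monoʳ-≤ (H (pos⁺ s ∷ ss) N)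
  (*-monoʳ-≤-nonNeg (H ss N) {{nonNegative (0≤H ss N)}} (1/^≤inv N s))

Sublinear : (ℕ → ℚ) → Set
Sublinear f = ∀ ε → 0ℚ < ε → ∃ λ C → ∀ N → f N ≤ C + ε * ι N

cancel : ∀ v c e n → v * n ≡ 1ℚ → v * (c + e * n) ≡ c * v + e
cancel v c e n vn≡1 = trans
  (solve 4 (λ v c e n → v :* (c :+ e :* n) := c :* v :+ e :* (v :* n)) refl v c e n)
  (cong (_+_ (c * v)) (trans (cong (e *_) vn≡1) (*-identityʳ e)))

sublinear⇒null : ∀ {f} → Sublinear f → ∀ ε → 0ℚ < ε →
                 ∃ λ K → ∀ i → K ℕ.≤ i → inv i * f (suc i) < ε
sublinear⇒null {f} sub ε 0<ε
  with C , f≤ ← sub (½ * ε) (0<½* 0<ε)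
  with K , h ← *inv-small C (½ * ε) (0<½* 0<ε) = K , λ i K≤i → ≤-<-trans
    (*-monoˡ-≤-nonNeg (inv i) {{nonNegative (0≤inv i)}} (f≤ (suc i)))
    (subst (_< ε) (sym (split C i)) (subst (_<_ (C * inv i + ½ * ε)) (½+½ ε)
      (+-monoˡ-< (½ * ε) (h i K≤i))))
  where
  split : ∀ C i → inv i * (C + ½ * ε * ι (suc i)) ≡ C * inv i + ½ * ε
  split C i = cancel (inv i) C (½ * ε) (ι (suc i)) (inv*ι i)

collect : ∀ h e {n m} → m ≡ 1ℚ + n → h + e * n + e ≡ h + e * m
collect h e {n} refl =
  solve 3 (λ h e n → h :+ e :* n :+ e := h :+ e :* (con 1ℚ :+ n)) refl h e n

module _ (s : ℕ⁺) (ss : List ℕ⁺) (K : ℕ) {ε : ℚ} (0<ε : 0ℚ < ε)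
         (h : ∀ i → K ℕ.≤ i → inv i * H ss (suc i) < ε) where

  increment≤ε : ∀ i → K ℕ.≤ i → inv i * H ss i ≤ ε
  increment≤ε i K≤i = ≤-trans
    (*-monoˡ-≤-nonNeg (inv i) {{nonNegative (0≤inv i)}} (H-mono ss (ℕ.n≤1+n i)))
    (<⇒≤ (h i K≤i))

  H≤-beyond : ∀ {N} → K ℕ.≤′ N → H (s ∷ ss) N ≤ H (s ∷ ss) K + ε * ι N
  H≤-beyond {N} (ℕ.≤′-reflexive refl) = p≤p+q (H (s ∷ ss) K) (0≤* (<⇒≤ 0<ε) (0≤ι N))
  H≤-beyond (ℕ.≤′-step {N} K≤N) = ≤-trans (H-step≤ s ss N)
    (subst (H (s ∷ ss) N + inv N * H ss N ≤_) (collect (H (s ∷ ss) K) ε (ι-suc N))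
      (+-mono-≤ (H≤-beyond K≤N) (increment≤ε N (ℕ.≤′⇒≤ K≤N))))

  H≤ : ∀ N → H (s ∷ ss) N ≤ H (s ∷ ss) K + ε * ι N
  H≤ N with ℕ.≤-total N K
  ... | inj₁ N≤K = ≤-trans (H-mono (s ∷ ss) N≤K) (p≤p+q (H (s ∷ ss) K) (0≤* (<⇒≤ 0<ε) (0≤ι N)))
  ... | inj₂ K≤N = H≤-beyond (ℕ.≤⇒≤′ K≤N)

H-sublinear : ∀ ss → Sublinear (H ss)
H-sublinear []       ε 0<ε = 1ℚ , λ N → p≤p+q 1ℚ (0≤* (<⇒≤ 0<ε) (0≤ι N))
H-sublinear (s ∷ ss) ε 0<ε =
  let K , h = sublinear⇒null (H-sublinear ss) ε 0<ε
  in  H (s ∷ ss) K , H≤ s ss K 0<ε h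

-- Summation by parts: remainder ss N bounds the sum of H ss (n - 1) / n² over
-- all n > N.

weight : ℕ → ℚ
weight zero    = 1ℚ + 1ℚ
weight (suc n) = inv n

0≤weight : ∀ n → 0ℚ ≤ weight n
0≤weight zero    = nonNegative⁻¹ (1ℚ + 1ℚ)
0≤weight (suc n) = 0≤inv n

weight-step : ∀ n → inv n * inv n + inv n ≤ weight n
weight-step zero    = ≤-reflexive (cong (λ v → v * v + v) (inv≡ 0))
weight-step (suc n) = subst (inv (suc n) * inv (suc n) + inv (suc n) ≤_) eq
  (+-monoˡ-≤ (inv (suc n)) (*-monoʳ-≤-nonNeg (inv (suc n)) {{nonNegative (0≤inv (suc n))}}
    (inv-antimono-≤ (ℕ.n≤1+n n))))
  where
  a = inv n
  b = inv (suc n)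
  eq : a * b + b ≡ a
  eq = trans (cong (_+_ (a * b)) (trans (sym (*-identityˡ b)) (cong (_* b) (sym (inv*ι n)))))
    (trans (solve 3 (λ a b n → a :* b :+ a :* n :* b := a :* (b :* (con 1ℚ :+ n))) refl a b (ι (suc n)))
    (trans (cong (λ z → a * (b * z)) (sym (ι-suc (suc n))))
    (trans (cong (a *_) (inv*ι (suc n))) (*-identityʳ a))))

remainder : List ℕ⁺ → ℕ → ℚ
remainder []       N = weight N
remainder (s ∷ ss) N = weight N * H (s ∷ ss) N + remainder ss N

0≤remainder : ∀ ss N → 0ℚ ≤ remainder ss N
0≤remainder []       N = 0≤weight N
0≤remainder (s ∷ ss) N = 0≤+ (0≤* (0≤weight N) (0≤H (s ∷ ss) N)) (0≤remainder ss N)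

remainder-step : ∀ ss N → inv N * inv N * H ss N + remainder ss (suc N) ≤ remainder ss N
remainder-step [] N = subst (λ z → z + inv N ≤ weight N) (sym (*-identityʳ (inv N * inv N))) (weight-step N)
remainder-step (s ∷ ss) N = ≤-trans
  (+-monoʳ-≤ (v * v * h) (+-monoˡ-≤ t
    (*-monoˡ-≤-nonNeg v {{nonNegative (0≤inv N)}} (H-step≤ s ss N))))
  (subst (_≤ weight N * h + remainder ss N)
    (solve 4 (λ v h g t → (v :* v :+ v) :* h :+ (v :* v :* g :+ t)
                       := v :* v :* h :+ (v :* (h :+ v :* g) :+ t)) refl v h (H ss N) t)
    (+-mono-≤ (*-monoʳ-≤-nonNeg h {{nonNegative (0≤H (s ∷ ss) N)}} (weight-step N))
              (remainder-step ss N)))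
  where
  v = inv N
  h = H (s ∷ ss) N
  t = remainder ss (suc N)

weight*H-null : ∀ ss ε → 0ℚ < ε → ∃ λ K → ∀ i → K ℕ.≤ i → weight i * H ss i < ε
weight*H-null ss ε 0<ε =
  let K , h = sublinear⇒null (H-sublinear ss) ε 0<ε
  in  suc K , λ { (suc i) (ℕ.s≤s K≤i) → h i K≤i }

remainder-null : ∀ ss ε → 0ℚ < ε → ∃ λ K → ∀ i → K ℕ.≤ i → remainder ss i < ε
remainder-null [] ε 0<ε =
  let K , h = weight*H-null [] ε 0<ε
  in  K , λ i K≤i → subst (_< ε) (*-identityʳ (weight i)) (h i K≤i)
remainder-null (s ∷ ss) ε 0<ε =
  let K₁ , h₁ = weight*H-null (s ∷ ss) (½ * ε) (0<½* 0<ε)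
      K₂ , h₂ = remainder-null ss (½ * ε) (0<½* 0<ε)
  in  K₁ ℕ.⊔ K₂ , λ i K≤i →
        subst (weight i * H (s ∷ ss) i + remainder ss i <_) (½+½ ε)
          (+-mono-< (h₁ i (ℕ.m⊔n≤o⇒m≤o K₁ K₂ K≤i)) (h₂ i (ℕ.m⊔n≤o⇒n≤o K₁ K₂ K≤i)))

module _ (s : ℕ⁺) .{{_ : NonTrivial (val s)}} (ss : List ℕ⁺) where

  H+remainder-antimono : ∀ {M N} → M ℕ.≤′ N →
                    H (s ∷ ss) N + remainder ss N ≤ H (s ∷ ss) M + remainder ss M
  H+remainder-antimono (ℕ.≤′-reflexive refl) = ≤-refl
  H+remainder-antimono (ℕ.≤′-step {N} M≤N) = ≤-trans
    (subst (_≤ H (s ∷ ss) N + remainder ss N)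
      (sym (+-assoc (H (s ∷ ss) N) _ (remainder ss (suc N))))
      (+-monoʳ-≤ (H (s ∷ ss) N) (≤-trans
        (+-monoˡ-≤ (remainder ss (suc N))
          (*-monoʳ-≤-nonNeg (H ss N) {{nonNegative (0≤H ss N)}} (1/^≤inv² N (val s))))
        (remainder-step ss N))))
    (H+remainder-antimono M≤N)

  upper : ∀ {M N} → M ℕ.≤ N → H (s ∷ ss) N ≤ H (s ∷ ss) M + remainder ss M
  upper {N = N} M≤N =
    ≤-trans (p≤p+q (H (s ∷ ss) N) (0≤remainder ss N)) (H+remainder-antimono (ℕ.≤⇒≤′ M≤N))

  H-cauchy : ∀ ε → 0ℚ < ε →
             ∃ λ N → ∀ p q → N ℕ.≤ p → N ℕ.≤ q → ∣ H (s ∷ ss) p - H (s ∷ ss) q ∣ < ε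
  H-cauchy ε 0<ε =
    let N , h = remainder-null ss ε 0<ε
    in  N , λ p q N≤p N≤q → ≤-<-trans
          (∣-∣-interval (H-mono (s ∷ ss) N≤p) (upper N≤p) (H-mono (s ∷ ss) N≤q) (upper N≤q))
          (h N ℕ.≤-refl)

-- The limit of the sums truncated at n₁ ≤ N, as N grows; NonTrivial s₁
-- means s₁ ≥ 2.  All terms are positive, so the order of summation is
-- immaterial.
ζ : (s₁ : ℕ) .{{_ : NonTrivial s₁}} → List ℕ⁺ → ℝ
ζ s₁ ss .seq    = H (pos⁺ s₁ {{ℕ.nonTrivial⇒nonZero s₁}} ∷ ss)
ζ s₁ ss .cauchy = H-cauchy (pos⁺ s₁ {{ℕ.nonTrivial⇒nonZero s₁}}) ss

{-# OPTIONS --safe #-}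

-- H ss N is the sum of the first coefficients of a multiple polylogarithm,
-- which arises from 1 by iterating the operators ∫ dz/z (letter x₀) and
-- ∫ dz/(1 - z) (letter x₁).  By the Leibniz rule for z d/dz, the Cauchy
-- product of the series of x₀ᵐx₁ʲ and x₀ⁿx₁ᵏ satisfies the recurrences of the
-- shuffle product.  These are solved by splitting each shuffle where the x₀'s
-- of one factor run out.  If they are the first factor's, or if all x₀'s
-- precede all x₁'s, the shuffle is counted in the first sum of the theorem;
-- otherwise it is counted in the second.  At z = 1, the partial sums of a Cauchy
-- product of nonnegative series are squeezed between products of partial sums.
module Submission where

open import Defs
import Data.Integer.Base as ℤ
open import Data.List.Base using (List; []; _∷_; foldr; map; concatMap; upTo; replicate; _++_)
import Data.List.Properties as List
open import Data.Nat.Base as ℕ using (ℕ; zero; suc; _+_; _*_; _∸_; NonTrivial; NonZero)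
open import Data.Nat.Combinatorics using (_C_; nCn≡1; nCk≡nC[n∸k]; nCk+nC[k+1]≡[n+1]C[k+1])
import Data.Nat.Properties as ℕ
open import Data.Product.Base using (_×_; _,_; proj₁; proj₂)
open import Data.Rational.Base as ℚ using (ℚ; 0ℚ; 1ℚ; _/_; _≤_; ∣_∣)
import Data.Rational.Properties as ℚ
open import Data.Rational.Solver using (module +-*-Solver)
open import Data.Vec.Base as Vec using (Vec; head; tail; toList)
open import Function.Base using (flip; _∘_)
open import Relation.Binary.PropositionalEquality

open +-*-Solver using (solve; _:=_; _:+_; _:*_; _:-_; con)
open ≡-Reasoning

infixl 6 _⊕_
infixr 7 _⊙_

-- Iterated integrals enter only through their power series coefficients, so the shuffle argument is
-- exact rational arithmetic: the two sums of the theorem, truncated at N, add up to the partial sum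
-- of degree N of the Cauchy product. Only the left side needs a limit argument, since the product
-- of its truncated factors runs over a square of index pairs and not over a triangle. Each
-- ingredient of the formula is a piece of a shuffled word. The binomials in m and n count the
-- orders in which the x₀'s of both factors are taken until one supply ends. Those in j and k count
-- the interleavings of the closing x₁'s, which all spell the same word. A tuple α or β spells the
-- stretch between, its first entry absorbing the initial x₀'s. In the second sum this stretch is
-- followed by the last x₀, hence the +1 on the final entry, and contains at least one x₁, hence t ≤
-- k - 1.

Seq : Set
Seq = ℕ → ℚ

_⊕_ : Seq → Seq → Seq
(f ⊕ g) n = f n ℚ.+ g n

_⊙_ : ℚ → Seq → Seq
(r ⊙ f) n = r ℚ.* f n

𝟘 : Seq
𝟘 _ = 0ℚ

-- The embedding of the natural numbers in the rationals

opaque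
  unfolding ι

  ι≡ : ∀ n → ℤ.+ n / 1 ≡ ι n
  ι≡ n = refl

  ι-0 : ι 0 ≡ 0ℚ
  ι-0 = refl

ι-1 : ι 1 ≡ 1ℚ
ι-1 = trans (ι-suc 0) (cong (1ℚ ℚ.+_) ι-0)

ι-+ : ∀ m n → ι (m + n) ≡ ι m ℚ.+ ι n
ι-+ zero    n = sym (trans (cong (ℚ._+ ι n) ι-0) (ℚ.+-identityˡ (ι n)))
ι-+ (suc m) n = begin
  ι (suc (m + n))          ≡⟨ ι-suc (m + n) ⟩
  1ℚ ℚ.+ ι (m + n)         ≡⟨ cong (1ℚ ℚ.+_) (ι-+ m n) ⟩
  1ℚ ℚ.+ (ι m ℚ.+ ι n)     ≡⟨ ℚ.+-assoc 1ℚ (ι m) (ι n) ⟨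
  1ℚ ℚ.+ ι m ℚ.+ ι n       ≡⟨ cong (ℚ._+ ι n) (ι-suc m) ⟨
  ι (suc m) ℚ.+ ι n        ∎

ι-* : ∀ m n → ι (m * n) ≡ ι m ℚ.* ι n
ι-* zero    n = trans ι-0 (sym (trans (cong (ℚ._* ι n) ι-0) (ℚ.*-zeroˡ (ι n))))
ι-* (suc m) n = begin
  ι (n + m * n)              ≡⟨ ι-+ n (m * n) ⟩
  ι n ℚ.+ ι (m * n)          ≡⟨ cong (ι n ℚ.+_) (ι-* m n) ⟩
  ι n ℚ.+ ι m ℚ.* ι n        ≡⟨ solve 2 (λ x y → y :+ x :* y := (con 1ℚ :+ x) :* y) refl (ι m) (ι n) ⟩
  (1ℚ ℚ.+ ι m) ℚ.* ι n       ≡⟨ cong (ℚ._* ι n) (ι-suc m) ⟨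
  ι (suc m) ℚ.* ι n          ∎

-- Finite sums

+-interchange : ∀ a b c d → (a ℚ.+ b) ℚ.+ (c ℚ.+ d) ≡ (a ℚ.+ c) ℚ.+ (b ℚ.+ d)
+-interchange = solve 4 (λ a b c d → (a :+ b) :+ (c :+ d) := (a :+ c) :+ (b :+ d)) refl

sum : {A : Set} → List A → (A → ℚ) → ℚ
sum xs f = foldr (λ x s → f x ℚ.+ s) 0ℚ xs

module _ {A : Set} where

  sum-cong : (xs : List A) {f g : A → ℚ} → f ≗ g → sum xs f ≡ sum xs g
  sum-cong []       f≗g = refl
  sum-cong (x ∷ xs) f≗g = cong₂ ℚ._+_ (f≗g x) (sum-cong xs f≗g)

  sum-++ : (xs ys : List A) (f : A → ℚ) → sum (xs ++ ys) f ≡ sum xs f ℚ.+ sum ys f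
  sum-++ []       ys f = sym (ℚ.+-identityˡ (sum ys f))
  sum-++ (x ∷ xs) ys f = trans (cong (f x ℚ.+_) (sum-++ xs ys f)) (sym (ℚ.+-assoc (f x) _ _))

  sum-map : {B : Set} (h : B → A) (xs : List B) (f : A → ℚ) → sum (map h xs) f ≡ sum xs (f ∘ h)
  sum-map h []       f = refl
  sum-map h (x ∷ xs) f = cong (f (h x) ℚ.+_) (sum-map h xs f)

  sum-concatMap : {B : Set} (h : B → List A) (xs : List B) (f : A → ℚ) →
                  sum (concatMap h xs) f ≡ sum xs (λ x → sum (h x) f)
  sum-concatMap h []       f = refl
  sum-concatMap h (x ∷ xs) f =
    trans (sum-++ (h x) (concatMap h xs) f) (cong (sum (h x) f ℚ.+_) (sum-concatMap h xs f))

sum-upTo-suc : ∀ n f → sum (upTo (suc n)) f ≡ f 0 ℚ.+ sum (upTo n) (f ∘ suc)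
sum-upTo-suc n f = cong (f 0 ℚ.+_)
  (trans (cong (λ xs → sum xs f) (sym (List.map-upTo suc n))) (sum-map suc (upTo n) f))

module _ {A : Set} where

  seq-∑ : (xs : List A) (f : A → ℝ) → ∀ N → seq (∑ xs f) N ≡ sum xs (λ x → seq (f x) N)
  seq-∑ []       f N = refl
  seq-∑ (x ∷ xs) f N = cong (seq (f x) N ℚ.+_) (seq-∑ xs f N)

sum-upTo-cong : ∀ n {f g : ℕ → ℚ} → (∀ i → i ℕ.< n → f i ≡ g i) → sum (upTo n) f ≡ sum (upTo n) g
sum-upTo-cong zero    f≗g = refl
sum-upTo-cong (suc n) {f} {g} f≗g = trans (sum-upTo-suc n f)
  (trans (cong₂ ℚ._+_ (f≗g 0 ℕ.z<s) (sum-upTo-cong n (λ i i<n → f≗g (suc i) (ℕ.s<s i<n))))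
         (sym (sum-upTo-suc n g)))

-- The sum over a + b = n. Shifting the first index in the recursion keeps truncated subtraction out
-- of all later inductions.
diag : (ℕ → ℕ → ℚ) → ℕ → ℚ
diag g zero    = g 0 0
diag g (suc n) = g 0 (suc n) ℚ.+ diag (g ∘ suc) n

diag-cong₊ : ∀ n {g h : ℕ → ℕ → ℚ} → (∀ a b → a + b ≡ n → g a b ≡ h a b) → diag g n ≡ diag h n
diag-cong₊ zero    g≗h = g≗h 0 0 refl
diag-cong₊ (suc n) g≗h =
  cong₂ ℚ._+_ (g≗h 0 (suc n) refl) (diag-cong₊ n (λ a b eq → g≗h (suc a) b (cong suc eq)))

diag-cong : ∀ n {g h : ℕ → ℕ → ℚ} → (∀ a b → g a b ≡ h a b) → diag g n ≡ diag h n
diag-cong n g≗h = diag-cong₊ n (λ a b _ → g≗h a b)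

diag-mono₊-≤ : ∀ n {g h : ℕ → ℕ → ℚ} → (∀ a b → a + b ≡ n → g a b ≤ h a b) → diag g n ≤ diag h n
diag-mono₊-≤ zero    g≤h = g≤h 0 0 refl
diag-mono₊-≤ (suc n) g≤h =
  ℚ.+-mono-≤ (g≤h 0 (suc n) refl) (diag-mono₊-≤ n (λ a b eq → g≤h (suc a) b (cong suc eq)))

diag-+ : ∀ n (g h : ℕ → ℕ → ℚ) → diag (λ a b → g a b ℚ.+ h a b) n ≡ diag g n ℚ.+ diag h n
diag-+ zero    g h = refl
diag-+ (suc n) g h =
  trans (cong (g 0 (suc n) ℚ.+ h 0 (suc n) ℚ.+_) (diag-+ n (g ∘ suc) (h ∘ suc)))
        (+-interchange (g 0 (suc n)) (h 0 (suc n)) _ _)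

diag-*ˡ : ∀ n r (g : ℕ → ℕ → ℚ) → diag (λ a b → r ℚ.* g a b) n ≡ r ℚ.* diag g n
diag-*ˡ zero    r g = refl
diag-*ˡ (suc n) r g =
  trans (cong (r ℚ.* g 0 (suc n) ℚ.+_) (diag-*ˡ n r (g ∘ suc))) (sym (ℚ.*-distribˡ-+ r _ _))

diag-sucʳ : ∀ n (g : ℕ → ℕ → ℚ) → diag g (suc n) ≡ diag (λ a b → g a (suc b)) n ℚ.+ g (suc n) 0
diag-sucʳ zero    g = refl
diag-sucʳ (suc n) g =
  trans (cong (g 0 (suc (suc n)) ℚ.+_) (diag-sucʳ n (g ∘ suc))) (sym (ℚ.+-assoc (g 0 (suc (suc n))) _ _))

diag-flip : ∀ n (g : ℕ → ℕ → ℚ) → diag (flip g) n ≡ diag g n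
diag-flip zero    g = refl
diag-flip (suc n) g =
  trans (ℚ.+-comm (g (suc n) 0) _)
    (trans (cong (ℚ._+ g (suc n) 0) (diag-flip n (λ a b → g a (suc b)))) (sym (diag-sucʳ n g)))

diag-swap : ∀ m n (g : ℕ → ℕ → ℕ → ℕ → ℚ) →
            diag (λ a b → diag (λ c d → g a b c d) n) m ≡ diag (λ c d → diag (λ a b → g a b c d) m) n
diag-swap zero    n g = refl
diag-swap (suc m) n g =
  trans (cong (diag (g 0 (suc m)) n ℚ.+_) (diag-swap m n (g ∘ suc))) (sym (diag-+ n (g 0 (suc m)) _))

sum-upTo-diag : ∀ n (g : ℕ → ℕ → ℚ) → sum (upTo (suc n)) (λ i → g i (n ∸ i)) ≡ diag g n
sum-upTo-diag zero    g = ℚ.+-identityʳ (g 0 0)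
sum-upTo-diag (suc n) g =
  trans (sum-upTo-suc (suc n) (λ i → g i (suc n ∸ i))) (cong (g 0 (suc n) ℚ.+_) (sum-upTo-diag n (g ∘ suc)))

-- Needed for the sum over t: as t stays below k, the complement k - t is always a successor.
sum-upTo-diag-suc : ∀ n (g : ℕ → ℕ → ℚ) →
                    sum (upTo (suc n)) (λ i → g i (suc n ∸ i)) ≡ diag (λ a b → g a (suc b)) n
sum-upTo-diag-suc zero    g = ℚ.+-identityʳ (g 0 1)
sum-upTo-diag-suc (suc n) g =
  trans (sum-upTo-suc (suc n) (λ i → g i (suc (suc n) ∸ i))) (cong (g 0 (suc (suc n)) ℚ.+_) (sum-upTo-diag-suc n (g ∘ suc)))

sum-antidiagonal : ∀ n (g : ℕ × ℕ → ℚ) → sum (antidiagonal n) g ≡ diag (λ a b → g (a , b)) n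
sum-antidiagonal n g =
  trans (sum-map (λ i → i , n ∸ i) (upTo (suc n)) g) (sum-upTo-diag n (λ a b → g (a , b)))

-- Linear operators on sequences

-- Sequences are compared pointwise, which is weaker than `≡`, so respecting `≗` is a condition of
-- its own.
record Linear (F : Seq → Seq) : Set where
  field
    resp-≗ : ∀ {f g} → f ≗ g → F f ≗ F g
    homo-⊕ : ∀ f g → F (f ⊕ g) ≗ F f ⊕ F g
    homo-⊙ : ∀ r f → F (r ⊙ f) ≗ r ⊙ F f

  homo-𝟘 : F 𝟘 ≗ 𝟘
  homo-𝟘 n = trans (resp-≗ (λ _ → sym (ℚ.*-zeroˡ 0ℚ)) n) (trans (homo-⊙ 0ℚ 𝟘 n) (ℚ.*-zeroˡ (F 𝟘 n)))

  homo-sum : {A : Set} (xs : List A) (f : A → Seq) →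
             F (λ i → sum xs (λ x → f x i)) ≗ λ i → sum xs (λ x → F (f x) i)
  homo-sum []       f i = homo-𝟘 i
  homo-sum (x ∷ xs) f i =
    trans (homo-⊕ (f x) (λ i → sum xs (λ x → f x i)) i) (cong (F (f x) i ℚ.+_) (homo-sum xs f i))

  homo-diag : ∀ n (g : ℕ → ℕ → Seq) →
              F (λ i → diag (λ a b → g a b i) n) ≗ λ i → diag (λ a b → F (g a b) i) n
  homo-diag zero    g i = refl
  homo-diag (suc n) g i =
    trans (homo-⊕ (g 0 (suc n)) (λ i → diag (λ a b → g (suc a) b i) n) i)
          (cong (F (g 0 (suc n)) i ℚ.+_) (homo-diag n (g ∘ suc) i))

open Linear

linear-id : Linear (λ f → f)
linear-id .resp-≗ f≗g   = f≗g
linear-id .homo-⊕ f g n = refl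
linear-id .homo-⊙ r f n = refl

linear-∘ : ∀ {F G} → Linear F → Linear G → Linear (F ∘ G)
linear-∘ F G .resp-≗ f≗g   = resp-≗ F (resp-≗ G f≗g)
linear-∘ F G .homo-⊕ f g n = trans (resp-≗ F (homo-⊕ G f g) n) (homo-⊕ F _ _ n)
linear-∘ F G .homo-⊙ r f n = trans (resp-≗ F (homo-⊙ G r f) n) (homo-⊙ F r _ n)

linear-⊕ : ∀ {F G} → Linear F → Linear G → Linear (λ f → F f ⊕ G f)
linear-⊕ F G .resp-≗ f≗g n = cong₂ ℚ._+_ (resp-≗ F f≗g n) (resp-≗ G f≗g n)
linear-⊕ {F} {G} lF lG .homo-⊕ f g n =
  trans (cong₂ ℚ._+_ (homo-⊕ lF f g n) (homo-⊕ lG f g n)) (+-interchange (F f n) (F g n) (G f n) (G g n))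
linear-⊕ F G .homo-⊙ r f n =
  trans (cong₂ ℚ._+_ (homo-⊙ F r f n) (homo-⊙ G r f n)) (sym (ℚ.*-distribˡ-+ r _ _))

linear-⊙ : ∀ r → Linear (r ⊙_)
linear-⊙ r .resp-≗ f≗g n   = cong (r ℚ.*_) (f≗g n)
linear-⊙ r .homo-⊕ f g n = ℚ.*-distribˡ-+ r (f n) (g n)
linear-⊙ r .homo-⊙ s f n = solve 3 (λ r s x → r :* (s :* x) := s :* (r :* x)) refl r s (f n)

-- On generating functions this is multiplication by z/(1 - z).
below : Seq → Seq
below f zero    = 0ℚ
below f (suc n) = below f n ℚ.+ f n

linear-below : Linear below
linear-below .resp-≗ f≗g zero      = refl
linear-below .resp-≗ f≗g (suc n)   = cong₂ ℚ._+_ (linear-below .resp-≗ f≗g n) (f≗g n)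
linear-below .homo-⊕ f g zero    = refl
linear-below .homo-⊕ f g (suc n) =
  trans (cong (ℚ._+ (f n ℚ.+ g n)) (linear-below .homo-⊕ f g n)) (+-interchange (below f n) (below g n) (f n) (g n))
linear-below .homo-⊙ r f zero    = sym (ℚ.*-zeroʳ r)
linear-below .homo-⊙ r f (suc n) =
  trans (cong (ℚ._+ r ℚ.* f n) (linear-below .homo-⊙ r f n)) (sym (ℚ.*-distribˡ-+ r _ _))

below-diag : ∀ n f → diag (λ a _ → f a) n ≡ below f (suc n)
below-diag zero    f = sym (ℚ.+-identityˡ (f 0))
below-diag (suc n) f = trans (diag-sucʳ n (λ a _ → f a)) (cong (ℚ._+ f (suc n)) (below-diag n f))

-- On the generating function F(z) = Σ f(n) zⁿ, the operator integrate x is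
-- ∫ F dz/z for x = x₀ and ∫ F dz/(1 - z) for x = x₁, and derivative x f is
-- z d/dz of it.
data Letter : Set where
  x₀ x₁ : Letter

derivative : Letter → Seq → Seq
derivative x₀ f = f
derivative x₁ f = below f

integrate : Letter → Seq → Seq
integrate x f zero    = 0ℚ
integrate x f (suc n) = inv n ℚ.* derivative x f (suc n)

integrate^ : Letter → ℕ → Seq → Seq
integrate^ x zero    f = f
integrate^ x (suc n) f = integrate x (integrate^ x n f)

linear-derivative : ∀ x → Linear (derivative x)
linear-derivative x₀ = linear-id
linear-derivative x₁ = linear-below

linear-integrate : ∀ x → Linear (integrate x)
linear-integrate x .resp-≗ f≗g zero    = refl
linear-integrate x .resp-≗ f≗g (suc n) =
  cong (inv n ℚ.*_) (linear-derivative x .resp-≗ f≗g (suc n))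
linear-integrate x .homo-⊕ f g zero    = refl
linear-integrate x .homo-⊕ f g (suc n) =
  trans (cong (inv n ℚ.*_) (linear-derivative x .homo-⊕ f g (suc n))) (ℚ.*-distribˡ-+ (inv n) _ _)
linear-integrate x .homo-⊙ r f zero    = sym (ℚ.*-zeroʳ r)
linear-integrate x .homo-⊙ r f (suc n) =
  trans (cong (inv n ℚ.*_) (linear-derivative x .homo-⊙ r f (suc n)))
        (linear-⊙ (inv n) .homo-⊙ r (derivative x f) (suc n))

linear-integrate^ : ∀ x n → Linear (integrate^ x n)
linear-integrate^ x zero    = linear-id
linear-integrate^ x (suc n) = linear-∘ (linear-integrate x) (linear-integrate^ x n)

integrate^-+ : ∀ x m n f → integrate^ x (m + n) f ≡ integrate^ x m (integrate^ x n f)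
integrate^-+ x zero    n f = refl
integrate^-+ x (suc m) n f = cong (integrate x) (integrate^-+ x m n f)

-- Multiplying the coefficients by n is z d/dz. It annihilates the constant term, so the hypothesis
-- is what makes it invert the integration at index 0.
ι*integrate : ∀ x f → derivative x f 0 ≡ 0ℚ → ∀ n → ι n ℚ.* integrate x f n ≡ derivative x f n
ι*integrate x f f₀≡0 zero    = trans (ℚ.*-zeroʳ (ι 0)) (sym f₀≡0)
ι*integrate x f f₀≡0 (suc n) = begin
  ι (suc n) ℚ.* (inv n ℚ.* d)    ≡⟨ solve 3 (λ i v d → i :* (v :* d) := (v :* i) :* d) refl (ι (suc n)) (inv n) d ⟩
  (inv n ℚ.* ι (suc n)) ℚ.* d    ≡⟨ cong (ℚ._* d) (inv*ι n) ⟩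
  1ℚ ℚ.* d                       ≡⟨ ℚ.*-identityˡ d ⟩
  d                              ∎
  where d = derivative x f (suc n)

-- Convolution

conv : Seq → Seq → Seq
conv f g n = diag (λ a b → f a ℚ.* g b) n

conv-cong : ∀ {f f′ g g′} → f ≗ f′ → g ≗ g′ → conv f g ≗ conv f′ g′
conv-cong f≗f′ g≗g′ n = diag-cong n (λ a b → cong₂ ℚ._*_ (f≗f′ a) (g≗g′ b))

conv-comm : ∀ f g → conv f g ≗ conv g f
conv-comm f g n =
  trans (diag-cong n (λ a b → ℚ.*-comm (f a) (g b))) (diag-flip n (λ a b → g a ℚ.* f b))

-- The factor z/(1 - z) can be moved out of a product of series.
conv-belowˡ : ∀ f g → conv (below f) g ≗ below (conv f g)
conv-belowˡ f g zero    = ℚ.*-zeroˡ (g 0)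
conv-belowˡ f g (suc n) = begin
  0ℚ ℚ.* g (suc n) ℚ.+ diag (λ a b → (below f a ℚ.+ f a) ℚ.* g b) n
    ≡⟨ cong₂ ℚ._+_ (ℚ.*-zeroˡ (g (suc n))) (diag-cong n (λ a b → ℚ.*-distribʳ-+ (g b) (below f a) (f a))) ⟩
  0ℚ ℚ.+ diag (λ a b → below f a ℚ.* g b ℚ.+ f a ℚ.* g b) n
    ≡⟨ trans (ℚ.+-identityˡ _) (diag-+ n (λ a b → below f a ℚ.* g b) (λ a b → f a ℚ.* g b)) ⟩
  conv (below f) g n ℚ.+ conv f g n
    ≡⟨ cong (ℚ._+ conv f g n) (conv-belowˡ f g n) ⟩
  below (conv f g) (suc n) ∎

conv-derivativeˡ : ∀ x f g → conv (derivative x f) g ≗ derivative x (conv f g)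
conv-derivativeˡ x₀ f g n = refl
conv-derivativeˡ x₁ f g n = conv-belowˡ f g n

conv-derivativeʳ : ∀ x f g → conv f (derivative x g) ≗ derivative x (conv f g)
conv-derivativeʳ x f g n = trans (conv-comm f (derivative x g) n)
  (trans (conv-derivativeˡ x g f n) (linear-derivative x .resp-≗ (conv-comm g f) n))

-- The Leibniz rule for z d/dz, integrated.
conv-integrate : ∀ x y f g → derivative x f 0 ≡ 0ℚ → derivative y g 0 ≡ 0ℚ →
                 conv (integrate x f) (integrate y g) ≗
                 integrate x (conv f (integrate y g)) ⊕ integrate y (conv (integrate x f) g)
conv-integrate x y f g f₀≡0 g₀≡0 zero    = refl
conv-integrate x y f g f₀≡0 g₀≡0 (suc n) = begin
  l                                          ≡⟨ ℚ.*-identityˡ l ⟨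
  1ℚ ℚ.* l                                   ≡⟨ cong (ℚ._* l) (inv*ι n) ⟨
  inv n ℚ.* ι (suc n) ℚ.* l                  ≡⟨ ℚ.*-assoc (inv n) (ι (suc n)) l ⟩
  inv n ℚ.* (ι (suc n) ℚ.* l)                ≡⟨ cong (inv n ℚ.*_) leibniz ⟩
  inv n ℚ.* (d x (conv f Ig) (suc n) ℚ.+ d y (conv If g) (suc n))
    ≡⟨ ℚ.*-distribˡ-+ (inv n) _ _ ⟩
  (integrate x (conv f Ig) ⊕ integrate y (conv If g)) (suc n) ∎
  where
  d  = derivative
  If = integrate x f
  Ig = integrate y g
  l  = conv If Ig (suc n)
  -- The product rule on coefficients: the degree a + b is shared between the two factors.
  split : ∀ a b → a + b ≡ suc n →
          ι (suc n) ℚ.* (If a ℚ.* Ig b) ≡ d x f a ℚ.* Ig b ℚ.+ If a ℚ.* d y g b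
  split a b eq = begin
    ι (suc n) ℚ.* (If a ℚ.* Ig b)        ≡⟨ cong (λ k → ι k ℚ.* (If a ℚ.* Ig b)) (sym eq) ⟩
    ι (a + b) ℚ.* (If a ℚ.* Ig b)        ≡⟨ cong (ℚ._* (If a ℚ.* Ig b)) (ι-+ a b) ⟩
    (ι a ℚ.+ ι b) ℚ.* (If a ℚ.* Ig b)
      ≡⟨ solve 4 (λ i j u v → (i :+ j) :* (u :* v) := (i :* u) :* v :+ u :* (j :* v)) refl (ι a) (ι b) (If a) (Ig b) ⟩
    ι a ℚ.* If a ℚ.* Ig b ℚ.+ If a ℚ.* (ι b ℚ.* Ig b)
      ≡⟨ cong₂ (λ u v → u ℚ.* Ig b ℚ.+ If a ℚ.* v) (ι*integrate x f f₀≡0 a) (ι*integrate y g g₀≡0 b) ⟩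
    d x f a ℚ.* Ig b ℚ.+ If a ℚ.* d y g b ∎
  leibniz : ι (suc n) ℚ.* l ≡ d x (conv f Ig) (suc n) ℚ.+ d y (conv If g) (suc n)
  leibniz = begin
    ι (suc n) ℚ.* l                                             ≡⟨ diag-*ˡ (suc n) (ι (suc n)) (λ a b → If a ℚ.* Ig b) ⟨
    diag (λ a b → ι (suc n) ℚ.* (If a ℚ.* Ig b)) (suc n)        ≡⟨ diag-cong₊ (suc n) split ⟩
    diag (λ a b → d x f a ℚ.* Ig b ℚ.+ If a ℚ.* d y g b) (suc n) ≡⟨ diag-+ (suc n) (λ a b → d x f a ℚ.* Ig b) (λ a b → If a ℚ.* d y g b) ⟩
    conv (d x f) Ig (suc n) ℚ.+ conv If (d y g) (suc n)
      ≡⟨ cong₂ ℚ._+_ (conv-derivativeˡ x f Ig (suc n)) (conv-derivativeʳ y If g (suc n)) ⟩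
    d x (conv f Ig) (suc n) ℚ.+ d y (conv If g) (suc n) ∎

-- The constant series 1: the unit of `conv` and the value of the empty word.
δ : Seq
δ zero    = 1ℚ
δ (suc _) = 0ℚ

diag-𝟘 : ∀ n {g : ℕ → ℕ → ℚ} → (∀ a b → g a b ≡ 0ℚ) → diag g n ≡ 0ℚ
diag-𝟘 zero    g≡0 = g≡0 0 0
diag-𝟘 (suc n) g≡0 = cong₂ ℚ._+_ (g≡0 0 (suc n)) (diag-𝟘 n (λ a b → g≡0 (suc a) b))

conv-identityˡ : ∀ f → conv δ f ≗ f
conv-identityˡ f zero    = ℚ.*-identityˡ (f 0)
conv-identityˡ f (suc n) =
  trans (cong₂ ℚ._+_ (ℚ.*-identityˡ (f (suc n))) (diag-𝟘 n (λ a b → ℚ.*-zeroˡ (f b))))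
        (ℚ.+-identityʳ (f (suc n)))

conv-identityʳ : ∀ f → conv f δ ≗ f
conv-identityʳ f n = trans (conv-comm f δ n) (conv-identityˡ f n)

-- Sums over words

word : ℕ → ℕ → Seq
word m j = integrate^ x₀ m (integrate^ x₁ j δ)

-- A word ending in x₁ has no constant term, so it may be integrated against dz/z; the empty word
-- may not.
word-0≡0 : ∀ m j → word m (suc j) 0 ≡ 0ℚ
word-0≡0 zero    j = refl
word-0≡0 (suc m) j = refl

-- The sum over all words in a letters x₀ and b letters x₁.
words : ℕ → ℕ → Seq → Seq
words a       zero    f = integrate^ x₀ a f
words zero    (suc b) f = integrate x₁ (words zero b f)
words (suc a) (suc b) f = integrate x₀ (words a (suc b) f) ⊕ integrate x₁ (words (suc a) b f)

linear-words : ∀ a b → Linear (words a b)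
linear-words a       zero    = linear-integrate^ x₀ a
linear-words zero    (suc b) = linear-∘ (linear-integrate x₁) (linear-words zero b)
linear-words (suc a) (suc b) = linear-⊕
  (linear-∘ (linear-integrate x₀) (linear-words a (suc b)))
  (linear-∘ (linear-integrate x₁) (linear-words (suc a) b))

diagWords : (ℕ → Seq) → ℕ → ℕ → Seq
diagWords u b a i = diag (λ b₁ b₂ → words a b₁ (u b₂) i) b

module _ (X : ℕ → ℕ → Seq) (u : ℕ → Seq)
         (X-0-0 : X 0 0 ≗ u 0)
         (X-suc-0 : ∀ b → X (suc b) 0 ≗ u (suc b) ⊕ integrate x₁ (X b 0))
         (X-0-suc : ∀ a → X 0 (suc a) ≗ integrate x₀ (X 0 a))
         (X-suc-suc : ∀ b a → X (suc b) (suc a) ≗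
                              integrate x₀ (X (suc b) a) ⊕ integrate x₁ (X b (suc a))) where

  -- Unfolding the recurrences spells a word: x₀ lowers a, x₁ lowers b, and `u b₂` may end the walk
  -- at any point (b₂ , 0). Every word in a letters x₀ and b - b₂ letters x₁ leads there exactly
  -- once.
  recurrence⇒diagWords : ∀ b a → X b a ≗ diagWords u b a
  recurrence⇒diagWords zero    zero    i = X-0-0 i
  recurrence⇒diagWords zero    (suc a) i = trans (X-0-suc a i)
    (linear-integrate x₀ .resp-≗ (recurrence⇒diagWords zero a) i)
  recurrence⇒diagWords (suc b) zero    i = trans (X-suc-0 b i) (cong (u (suc b) i ℚ.+_)
    (trans (linear-integrate x₁ .resp-≗ (recurrence⇒diagWords b zero) i)
           (homo-diag (linear-integrate x₁) b (λ b₁ b₂ → words 0 b₁ (u b₂)) i)))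
  recurrence⇒diagWords (suc b) (suc a) i = begin
    X (suc b) (suc a) i
      ≡⟨ X-suc-suc b a i ⟩
    I₀ (X (suc b) a) i ℚ.+ I₁ (X b (suc a)) i
      ≡⟨ cong₂ ℚ._+_ (linear-integrate x₀ .resp-≗ (recurrence⇒diagWords (suc b) a) i)
                     (linear-integrate x₁ .resp-≗ (recurrence⇒diagWords b (suc a)) i) ⟩
    I₀ (diagWords u (suc b) a) i ℚ.+ I₁ (diagWords u b (suc a)) i
      ≡⟨ cong₂ ℚ._+_ (homo-diag (linear-integrate x₀) (suc b) (λ b₁ b₂ → words a b₁ (u b₂)) i)
                     (homo-diag (linear-integrate x₁) b (λ b₁ b₂ → words (suc a) b₁ (u b₂)) i) ⟩
    -- The term without x₁ must begin with x₀; all others pair up by first letter, as in the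
    -- definition of `words`.
    (I₀ (words a 0 (u (suc b))) i ℚ.+ diag p b) ℚ.+ diag q b
      ≡⟨ ℚ.+-assoc (I₀ (words a 0 (u (suc b))) i) (diag p b) (diag q b) ⟩
    I₀ (words a 0 (u (suc b))) i ℚ.+ (diag p b ℚ.+ diag q b)
      ≡⟨ cong (I₀ (words a 0 (u (suc b))) i ℚ.+_) (sym (diag-+ b p q)) ⟩
    diagWords u (suc b) (suc a) i ∎
    where
    I₀ = integrate x₀
    I₁ = integrate x₁
    p = λ b₁ b₂ → I₀ (words a (suc b₁) (u b₂)) i
    q = λ b₁ b₂ → I₁ (words (suc a) b₁ (u b₂)) i

-- Pascal's rule and lattice paths

nC0≡1 : ∀ n → n C 0 ≡ 1
nC0≡1 n = trans (nCk≡nC[n∸k] {0} {n} ℕ.z≤n) (nCn≡1 n)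

n+0Cn≡1 : ∀ n → (n + 0) C n ≡ 1
n+0Cn≡1 n = trans (cong (_C n) (ℕ.+-identityʳ n)) (nCn≡1 n)

ι-pascal : ∀ m n → ι ((suc m + suc n) C suc m) ≡ ι ((m + suc n) C m) ℚ.+ ι ((suc m + n) C suc m)
ι-pascal m n = begin
  ι (suc (m + suc n) C suc m)                           ≡⟨ cong ι (nCk+nC[k+1]≡[n+1]C[k+1] (m + suc n) m) ⟨
  ι ((m + suc n) C m + (m + suc n) C suc m)             ≡⟨ ι-+ ((m + suc n) C m) _ ⟩
  ι ((m + suc n) C m) ℚ.+ ι ((m + suc n) C suc m)
    ≡⟨ cong (λ l → ι ((m + suc n) C m) ℚ.+ ι (l C suc m)) (ℕ.+-suc m n) ⟩
  ι ((m + suc n) C m) ℚ.+ ι ((suc m + n) C suc m)       ∎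

ι≡1⇒⊙ : ∀ {n} → n ≡ 1 → ∀ f → ι n ⊙ f ≗ f
ι≡1⇒⊙ refl f i = trans (cong (ℚ._* f i) ι-1) (ℚ.*-identityˡ (f i))

-- A path from (m + 1 , n₁ + n₂) that stops at (0 , n₂) has its last step in the first coordinate;
-- the other m such steps mix freely with the n₁ steps in the second, hence the binomial.
latticeTerm : (ℕ → Seq) → ℕ → ℕ → ℕ → Seq
latticeTerm a m n₁ n₂ = ι ((m + n₁) C m) ⊙ integrate^ x₀ (suc (m + n₁)) (a n₂)

-- The sum over all lattice paths from (m , n) that stop on reaching first
-- coordinate 0, each step being an x₀; a n is what remains at (0 , n).
lattice : (ℕ → Seq) → ℕ → ℕ → Seq
lattice a zero    n   = a n
lattice a (suc m) n i = diag (λ n₁ n₂ → latticeTerm a m n₁ n₂ i) n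

lattice-0 : ∀ a m → lattice a m 0 ≗ integrate^ x₀ m (a 0)
lattice-0 a zero    i = refl
lattice-0 a (suc m) i =
  trans (ι≡1⇒⊙ (n+0Cn≡1 m) (integrate^ x₀ (suc (m + 0)) (a 0)) i)
        (cong (λ l → integrate^ x₀ (suc l) (a 0) i) (ℕ.+-identityʳ m))

integrate-lattice : ∀ a m n → integrate x₀ (lattice a (suc m) n) ≗
  λ i → diag (λ n₁ n₂ → ι ((m + n₁) C m) ℚ.* integrate^ x₀ (suc (suc (m + n₁))) (a n₂) i) n
integrate-lattice a m n i =
  trans (homo-diag (linear-integrate x₀) n (latticeTerm a m) i)
        (diag-cong n (λ n₁ n₂ → linear-integrate x₀ .homo-⊙ (ι ((m + n₁) C m))
                                  (integrate^ x₀ (suc (m + n₁)) (a n₂)) i))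

-- Split the paths by their first step; on coefficients this is Pascal's rule.
lattice-step : ∀ a m n → lattice a (suc m) (suc n) ≗
               integrate x₀ (lattice a m (suc n)) ⊕ integrate x₀ (lattice a (suc m) n)
lattice-step a zero n i = cong₂ ℚ._+_
  (ι≡1⇒⊙ (nC0≡1 0) (integrate x₀ (a (suc n))) i)
  (trans
    (diag-cong n (λ n₁ n₂ → cong (λ c → ι c ℚ.* integrate^ x₀ (suc (suc n₁)) (a n₂) i)
                                 (trans (nC0≡1 (suc n₁)) (sym (nC0≡1 n₁)))))
    (sym (integrate-lattice a zero n i)))
lattice-step a (suc m) n i = begin
  g 0 (suc n) ℚ.+ diag (g ∘ suc) n
    ≡⟨ cong₂ ℚ._+_
         (cong (λ c → ι c ℚ.* integrate^ x₀ (suc (suc (m + 0))) (a (suc n)) i)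
               (trans (n+0Cn≡1 (suc m)) (sym (n+0Cn≡1 m))))
         (trans (diag-cong n pascal) (diag-+ n (h ∘ suc) k)) ⟩
  h 0 (suc n) ℚ.+ (diag (h ∘ suc) n ℚ.+ diag k n)
    ≡⟨ ℚ.+-assoc (h 0 (suc n)) (diag (h ∘ suc) n) (diag k n) ⟨
  diag h (suc n) ℚ.+ diag k n
    ≡⟨ cong₂ ℚ._+_ (integrate-lattice a m (suc n) i) (integrate-lattice a (suc m) n i) ⟨
  integrate x₀ (lattice a (suc m) (suc n)) i ℚ.+ integrate x₀ (lattice a (suc (suc m)) n) i ∎
  where
  I^ : ℕ → ℕ → ℚ
  I^ e n₂ = integrate^ x₀ e (a n₂) i
  g h k : ℕ → ℕ → ℚ
  g n₁ n₂ = ι ((suc m + n₁) C suc m) ℚ.* I^ (suc (suc m + n₁)) n₂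
  h n₁ n₂ = ι ((m + n₁) C m) ℚ.* I^ (suc (suc (m + n₁))) n₂
  k n₁ n₂ = ι ((suc m + n₁) C suc m) ℚ.* I^ (suc (suc (suc m + n₁))) n₂
  pascal : ∀ n₁ n₂ → g (suc n₁) n₂ ≡ h (suc n₁) n₂ ℚ.+ k n₁ n₂
  pascal n₁ n₂ = begin
    g (suc n₁) n₂
      ≡⟨ cong (ℚ._* I^ (suc (suc m + suc n₁)) n₂) (ι-pascal m n₁) ⟩
    (ι ((m + suc n₁) C m) ℚ.+ ι ((suc m + n₁) C suc m)) ℚ.* I^ (suc (suc m + suc n₁)) n₂
      ≡⟨ ℚ.*-distribʳ-+ (I^ (suc (suc m + suc n₁)) n₂) (ι ((m + suc n₁) C m)) (ι ((suc m + n₁) C suc m)) ⟩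
    h (suc n₁) n₂ ℚ.+ ι ((suc m + n₁) C suc m) ℚ.* I^ (suc (suc m + suc n₁)) n₂
      ≡⟨ cong (λ l → h (suc n₁) n₂ ℚ.+ ι ((suc m + n₁) C suc m) ℚ.* I^ (suc (suc l)) n₂) (ℕ.+-suc m n₁) ⟩
    h (suc n₁) n₂ ℚ.+ k n₁ n₂ ∎

module _ (X : ℕ → ℕ → Seq) (a b : ℕ → Seq)
         (X-0-n : ∀ n → X 0 n ≗ a n)
         (X-suc-0 : ∀ m → X (suc m) 0 ≗ integrate^ x₀ (suc m) (a 0) ⊕ b m)
         (X-suc-suc : ∀ m n → X (suc m) (suc n) ≗
                              integrate x₀ (X m (suc n)) ⊕ integrate x₀ (X (suc m) n)) where

  private
    I₀ = integrate x₀

    -- The lattice with its axes exchanged. Its index is shifted because `b m` sits at (m + 1 , 0),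
    -- while the axis (0 , n) already belongs to `a`.
    other : ℕ → ℕ → Seq
    other zero    n = 𝟘
    other (suc m) n = lattice b n m

    other-step : ∀ m n → other (suc m) (suc n) ≗ I₀ (other m (suc n)) ⊕ I₀ (other (suc m) n)
    other-step zero    n i = begin
      lattice b (suc n) 0 i             ≡⟨ lattice-0 b (suc n) i ⟩
      I₀ (integrate^ x₀ n (b 0)) i      ≡⟨ linear-integrate x₀ .resp-≗ (lattice-0 b n) i ⟨
      I₀ (lattice b n 0) i              ≡⟨ ℚ.+-identityˡ (I₀ (lattice b n 0) i) ⟨
      0ℚ ℚ.+ I₀ (lattice b n 0) i       ≡⟨ cong (ℚ._+ I₀ (lattice b n 0) i) (homo-𝟘 (linear-integrate x₀) i) ⟨
      I₀ 𝟘 i ℚ.+ I₀ (lattice b n 0) i   ∎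
    other-step (suc m) n i = trans (lattice-step b n m i)
      (ℚ.+-comm (I₀ (lattice b n (suc m)) i) (I₀ (lattice b (suc n) m) i))

  -- Superposition: the step is linear and both summands obey it, so only boundary values matter.
  -- The `a`-part takes the value `integrate^ x₀ m (a 0)` at (m , 0), so `b` has to supply only the
  -- excess there.
  recurrence⇒lattice : ∀ m n → X m n ≗ lattice a m n ⊕ other m n
  recurrence⇒lattice zero    n       i = trans (X-0-n n i) (sym (ℚ.+-identityʳ (a n i)))
  recurrence⇒lattice (suc m) zero    i =
    trans (X-suc-0 m i) (cong (ℚ._+ b m i) (sym (lattice-0 a (suc m) i)))
  recurrence⇒lattice (suc m) (suc n) i = begin
    X (suc m) (suc n) i
      ≡⟨ X-suc-suc m n i ⟩
    I₀ (X m (suc n)) i ℚ.+ I₀ (X (suc m) n) i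
      ≡⟨ cong₂ ℚ._+_ (expand m (suc n)) (expand (suc m) n) ⟩
    (I₀ (lattice a m (suc n)) i ℚ.+ I₀ (other m (suc n)) i) ℚ.+
    (I₀ (lattice a (suc m) n) i ℚ.+ I₀ (other (suc m) n) i)
      ≡⟨ +-interchange (I₀ (lattice a m (suc n)) i) (I₀ (other m (suc n)) i)
                       (I₀ (lattice a (suc m) n) i) (I₀ (other (suc m) n) i) ⟩
    (I₀ (lattice a m (suc n)) i ℚ.+ I₀ (lattice a (suc m) n) i) ℚ.+
    (I₀ (other m (suc n)) i ℚ.+ I₀ (other (suc m) n) i)
      ≡⟨ cong₂ ℚ._+_ (lattice-step a m n i) (other-step m n i) ⟨
    (lattice a (suc m) (suc n) ⊕ other (suc m) (suc n)) i ∎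
    where
    expand : ∀ m n → I₀ (X m n) i ≡ I₀ (lattice a m n) i ℚ.+ I₀ (other m n) i
    expand m n = trans (linear-integrate x₀ .resp-≗ (recurrence⇒lattice m n) i)
                       (linear-integrate x₀ .homo-⊕ (lattice a m n) (other m n) i)

-- Shuffles of x₀ᵐx₁ʲ with x₀ⁿx₁ᵏ

integrate^-integrate : ∀ x n f → integrate^ x n (integrate x f) ≡ integrate x (integrate^ x n f)
integrate^-integrate x zero    f = refl
integrate^-integrate x (suc n) f = cong (integrate x) (integrate^-integrate x n f)

-- All interleavings of equal letters spell one word; choosing the factor that gives the first
-- letter yields Pascal's rule.
conv-x₁^ : ∀ j k → conv (word 0 j) (word 0 k) ≗ ι ((j + k) C j) ⊙ word 0 (j + k)
conv-x₁^ zero    k       i = trans (conv-identityˡ (word 0 k) i) (sym (ι≡1⇒⊙ (nC0≡1 k) (word 0 k) i))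
conv-x₁^ (suc j) zero    i = trans (conv-identityʳ (word 0 (suc j)) i)
  (trans (cong (λ l → word 0 (suc l) i) (sym (ℕ.+-identityʳ j)))
         (sym (ι≡1⇒⊙ (n+0Cn≡1 (suc j)) (word 0 (suc j + 0)) i)))
conv-x₁^ (suc j) (suc k) i = begin
  conv (word 0 (suc j)) (word 0 (suc k)) i
    ≡⟨ conv-integrate x₁ x₁ (word 0 j) (word 0 k) refl refl i ⟩
  I₁ (conv (word 0 j) (word 0 (suc k))) i ℚ.+ I₁ (conv (word 0 (suc j)) (word 0 k)) i
    ≡⟨ cong₂ ℚ._+_ (expand j (suc k) (conv-x₁^ j (suc k))) (expand (suc j) k (conv-x₁^ (suc j) k)) ⟩
  ι ((j + suc k) C j) ℚ.* word 0 (suc j + suc k) i ℚ.+ ι ((suc j + k) C suc j) ℚ.* word 0 (suc (suc j + k)) i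
    ≡⟨ cong (λ l → ι ((j + suc k) C j) ℚ.* word 0 (suc j + suc k) i ℚ.+ ι ((suc j + k) C suc j) ℚ.* word 0 (suc l) i)
            (ℕ.+-suc j k) ⟨
  ι ((j + suc k) C j) ℚ.* word 0 (suc j + suc k) i ℚ.+ ι ((suc j + k) C suc j) ℚ.* word 0 (suc j + suc k) i
    ≡⟨ ℚ.*-distribʳ-+ (word 0 (suc j + suc k) i) (ι ((j + suc k) C j)) (ι ((suc j + k) C suc j)) ⟨
  (ι ((j + suc k) C j) ℚ.+ ι ((suc j + k) C suc j)) ℚ.* word 0 (suc j + suc k) i
    ≡⟨ cong (ℚ._* word 0 (suc j + suc k) i) (ι-pascal j k) ⟨
  ι ((suc j + suc k) C suc j) ℚ.* word 0 (suc j + suc k) i ∎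
  where
  I₁ = integrate x₁
  expand : ∀ j k → conv (word 0 j) (word 0 k) ≗ ι ((j + k) C j) ⊙ word 0 (j + k) →
           I₁ (conv (word 0 j) (word 0 k)) i ≡ ι ((j + k) C j) ℚ.* I₁ (word 0 (j + k)) i
  expand j k eq = trans (linear-integrate x₁ .resp-≗ eq i)
    (linear-integrate x₁ .homo-⊙ (ι ((j + k) C j)) (word 0 (j + k)) i)

module _ (j k : ℕ) where

  private
    I₀ = integrate x₀
    I₁ = integrate x₁

  -- The shuffles that remain once the x₀'s of the first factor have run out, n
  -- of those of the second being left.
  afterX₀ˡ : ℕ → Seq
  afterX₀ˡ = diagWords (λ j₂ → I₁ (conv (word 0 j₂) (word 0 k))) (suc j)

  -- The same for the second factor, with suc m of the first factor's x₀'s left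
  -- and at least one x₁ among them: the all-x₀-first shuffles are already in
  -- lattice afterX₀ˡ, through its value at 0.
  afterX₀ʳ : ℕ → Seq
  afterX₀ʳ m i = diag (λ t k₁ → words m (suc k₁) (I₀ (conv (word 0 (suc j)) (word 0 t))) i) k

  -- Cut each shuffle at the first x₁ of the second factor. Before it, that factor's x₀'s mix freely
  -- with x₁'s of the first; after it, only x₁'s remain.
  conv-afterX₀ˡ : ∀ n → conv (word 0 (suc j)) (word n (suc k)) ≗ afterX₀ˡ n
  conv-afterX₀ˡ = recurrence⇒diagWords (λ j n → conv (word 0 j) (word n (suc k))) u
    (λ i → trans (conv-identityˡ (word 0 (suc k)) i)
             (sym (linear-integrate x₁ .resp-≗ (conv-identityˡ (word 0 k)) i)))
    (λ j i → trans (conv-integrate x₁ x₁ (word 0 j) (word 0 k) refl refl i)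
               (ℚ.+-comm (I₁ (conv (word 0 j) (word 0 (suc k))) i) (u (suc j) i)))
    (λ n i → trans (conv-identityˡ (word (suc n) (suc k)) i)
               (sym (linear-integrate x₀ .resp-≗ (conv-identityˡ (word n (suc k))) i)))
    (λ j n i → trans (conv-integrate x₁ x₀ (word 0 j) (word n (suc k)) refl (word-0≡0 n k) i)
                 (ℚ.+-comm (I₁ (conv (word 0 j) (word (suc n) (suc k))) i)
                           (I₀ (conv (word 0 (suc j)) (word n (suc k))) i)))
    (suc j)
    where
    u : ℕ → Seq
    u j₂ = I₁ (conv (word 0 j₂) (word 0 k))

  -- Cut each shuffle at the last x₀, which belongs to the first factor: m letters x₀ and some x₁'s
  -- of the second factor precede it, and only x₁'s follow.
  conv-afterX₀ʳ : ∀ m → conv (word (suc m) (suc j)) (word 0 (suc k)) ≗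
                  integrate^ x₀ (suc m) (afterX₀ˡ 0) ⊕ afterX₀ʳ m
  conv-afterX₀ʳ m i = trans
    (recurrence⇒diagWords (λ k m → conv (word (suc m) (suc j)) (word 0 k)) u
      (λ i → trans (conv-identityʳ (word 1 (suc j)) i)
               (sym (linear-integrate x₀ .resp-≗ (conv-identityʳ (word 0 (suc j))) i)))
      (λ k i → conv-integrate x₀ x₁ (word 0 (suc j)) (word 0 k) refl refl i)
      (λ m i → trans (conv-identityʳ (word (suc (suc m)) (suc j)) i)
                 (sym (linear-integrate x₀ .resp-≗ (conv-identityʳ (word (suc m) (suc j))) i)))
      (λ k m i → conv-integrate x₀ x₁ (word (suc m) (suc j)) (word 0 k) refl refl i)
      (suc k) m i)
    -- The head of the diagonal sum has no x₁ before the last x₀, which is the part credited to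
    -- `afterX₀ˡ 0`.
    (cong₂ ℚ._+_
      (trans (cong (λ f → f i) (integrate^-integrate x₀ m (conv (word 0 (suc j)) (word 0 (suc k)))))
             (linear-integrate^ x₀ (suc m) .resp-≗ (conv-afterX₀ˡ 0) i))
      (diag-flip k (λ t k₁ → words m (suc k₁) (u t) i)))
    where
    u : ℕ → Seq
    u t = I₀ (conv (word 0 (suc j)) (word 0 t))

  conv-words : ∀ m n → conv (word (suc m) (suc j)) (word (suc n) (suc k)) ≗
               lattice afterX₀ˡ (suc m) (suc n) ⊕ lattice afterX₀ʳ (suc n) m
  conv-words m n = recurrence⇒lattice (λ m n → conv (word m (suc j)) (word n (suc k)))
    afterX₀ˡ afterX₀ʳ conv-afterX₀ˡ conv-afterX₀ʳ
    (λ m n → conv-integrate x₀ x₀ (word m (suc j)) (word n (suc k)) (word-0≡0 m j) (word-0≡0 n k))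
    (suc m) (suc n)

-- Coefficients of multiple polylogarithms

coeff : List ℕ⁺ → Seq
coeff []       n       = δ n
coeff (s ∷ ss) zero    = 0ℚ
coeff (s ∷ ss) (suc n) = 1/[1+ n ]^ val s ℚ.* H ss n

-- Evaluation at z = 1 up to degree N; the shift arises because `below` is a strict partial sum.
below-coeff : ∀ ss N → below (coeff ss) (suc N) ≡ H ss N
below-coeff []       zero    = refl
below-coeff []       (suc N) = cong (ℚ._+ 0ℚ) (below-coeff [] N)
below-coeff (s ∷ ss) zero    = refl
below-coeff (s ∷ ss) (suc N) = cong (ℚ._+ 1/[1+ N ]^ val s ℚ.* H ss N) (below-coeff (s ∷ ss) N)

0≤coeff : ∀ ss n → 0ℚ ≤ coeff ss n
0≤coeff []       zero    = ℚ.nonNegative⁻¹ 1ℚ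
0≤coeff []       (suc n) = ℚ.≤-refl
0≤coeff (s ∷ ss) zero    = ℚ.≤-refl
0≤coeff (s ∷ ss) (suc n) = 0≤* (0≤1/^ n (val s)) (0≤H ss n)

1/^-suc : ∀ n s → 1/[1+ n ]^ suc s ≡ inv n ℚ.* 1/[1+ n ]^ s
1/^-suc n s = trans
  (1/-*-homo (suc n) (suc n ℕ.^ s) {{_}} {{ℕ.m^n≢0 (suc n) s}} {{ℕ.m^n≢0 (suc n) (suc s)}})
  (cong (ℚ._* 1/[1+ n ]^ s) (sym (inv≡ n)))

-- An exponent s + 1 is spelled x₀ˢx₁: the letter x₁ forms the inner partial sum and divides by n
-- once, and each x₀ divides by n again.
coeff-∷ : ∀ s .{{_ : NonZero (suc s)}} ss →
          coeff (pos⁺ (suc s) ∷ ss) ≗ integrate^ x₀ s (integrate x₁ (coeff ss))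
coeff-∷ zero    ss zero    = refl
coeff-∷ zero    ss (suc n) =
  cong₂ ℚ._*_ (trans (1/^-suc n 0) (ℚ.*-identityʳ (inv n))) (sym (below-coeff ss n))
coeff-∷ (suc s) ss zero    = refl
coeff-∷ (suc s) ss (suc n) = begin
  1/[1+ n ]^ suc (suc s) ℚ.* H ss n           ≡⟨ cong (ℚ._* H ss n) (1/^-suc n (suc s)) ⟩
  inv n ℚ.* 1/[1+ n ]^ suc s ℚ.* H ss n       ≡⟨ ℚ.*-assoc (inv n) (1/[1+ n ]^ suc s) (H ss n) ⟩
  inv n ℚ.* (1/[1+ n ]^ suc s ℚ.* H ss n)     ≡⟨ cong (inv n ℚ.*_) (coeff-∷ s ss (suc n)) ⟩
  inv n ℚ.* integrate^ x₀ s (integrate x₁ (coeff ss)) (suc n) ∎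

coeff-raise : ∀ e s s′ ss → val s′ ≡ val s + e →
              coeff (s′ ∷ ss) ≗ integrate^ x₀ e (coeff (s ∷ ss))
coeff-raise e (pos⁺ (suc s)) (pos⁺ (suc s′)) ss eq i = begin
  coeff (pos⁺ (suc s′) ∷ ss) i                              ≡⟨ coeff-∷ s′ ss i ⟩
  integrate^ x₀ s′ f i
    ≡⟨ cong (λ l → integrate^ x₀ l f i) (trans (ℕ.suc-injective eq) (ℕ.+-comm s e)) ⟩
  integrate^ x₀ (e + s) f i                                 ≡⟨ cong (λ g → g i) (integrate^-+ x₀ e s f) ⟩
  integrate^ x₀ e (integrate^ x₀ s f) i
    ≡⟨ linear-integrate^ x₀ e .resp-≗ (coeff-∷ s ss) i ⟨
  integrate^ x₀ e (coeff (pos⁺ (suc s) ∷ ss)) i             ∎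
  where f = integrate x₁ (coeff ss)

coeff-replicate : ∀ n → coeff (replicate n 1⁺) ≗ word 0 n
coeff-replicate zero    i = refl
coeff-replicate (suc n) i =
  trans (coeff-∷ 0 (replicate n 1⁺) i) (linear-integrate x₁ .resp-≗ (coeff-replicate n) i)

-- The x₁ closing the last entry is left to `f`. So d + 1 entries spell a word with exactly d
-- letters x₁, and every such word arises.
tupleWord : ∀ {d} → Vec ℕ⁺ (suc d) → Seq → Seq
tupleWord (s Vec.∷ Vec.[])         f = integrate^ x₀ (ℕ.pred (val s)) f
tupleWord (s Vec.∷ ss@(_ Vec.∷ _)) f = integrate^ x₀ (ℕ.pred (val s)) (integrate x₁ (tupleWord ss f))

linear-tupleWord : ∀ {d} (α : Vec ℕ⁺ (suc d)) → Linear (tupleWord α)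
linear-tupleWord (s Vec.∷ Vec.[])        = linear-integrate^ x₀ (ℕ.pred (val s))
linear-tupleWord (s Vec.∷ α@(_ Vec.∷ _)) =
  linear-∘ (linear-integrate^ x₀ (ℕ.pred (val s))) (linear-∘ (linear-integrate x₁) (linear-tupleWord α))

coeff-tupleWord : ∀ {d} (α : Vec ℕ⁺ (suc d)) ss →
                  coeff (toList α ++ ss) ≗ tupleWord α (integrate x₁ (coeff ss))
coeff-tupleWord (pos⁺ (suc s) Vec.∷ Vec.[])         ss i = coeff-∷ s ss i
coeff-tupleWord (pos⁺ (suc s) Vec.∷ α@(_ Vec.∷ _)) ss i = trans (coeff-∷ s (toList α ++ ss) i)
  (linear-∘ (linear-integrate^ x₀ s) (linear-integrate x₁) .resp-≗ (coeff-tupleWord α ss) i)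

-- The increment inserts an x₀ just before the closing x₁; this is the last x₀ at which `afterX₀ʳ`
-- cuts.
coeff-incrementLast : ∀ {d} (α : Vec ℕ⁺ (suc d)) ss →
                      coeff (toList (incrementLast α) ++ ss) ≗
                      tupleWord α (integrate x₀ (integrate x₁ (coeff ss)))
coeff-incrementLast (pos⁺ (suc s) Vec.∷ Vec.[])         ss i = trans (coeff-∷ (suc s) ss i)
  (cong (λ f → f i) (sym (integrate^-integrate x₀ s (integrate x₁ (coeff ss)))))
coeff-incrementLast (pos⁺ (suc s) Vec.∷ α@(_ Vec.∷ _)) ss i =
  trans (coeff-∷ s (toList (incrementLast α) ++ ss) i)
  (linear-∘ (linear-integrate^ x₀ s) (linear-integrate x₁) .resp-≗ (coeff-incrementLast α ss) i)

incrementHead : ∀ {d} → Vec ℕ⁺ (suc d) → Vec ℕ⁺ (suc d)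
incrementHead (s Vec.∷ ss) = suc⁺ s Vec.∷ ss

sum-tuples : ∀ d n (f : Vec ℕ⁺ (suc d) → ℚ) →
             sum (tuples (suc d) n) f ≡
             sum (upTo n) (λ i → sum (tuples d (n ∸ suc i)) (λ α → f (pos⁺ (suc i) Vec.∷ α)))
sum-tuples d n f = trans
  (sum-concatMap (λ i → map (pos⁺ (suc i) Vec.∷_) (tuples d (n ∸ suc i))) (upTo n) f)
  (sum-cong (upTo n) (λ i → sum-map (pos⁺ (suc i) Vec.∷_) (tuples d (n ∸ suc i)) f))

sum-tuples-suc : ∀ d n (f : Vec ℕ⁺ (suc d) → ℚ) →
                 sum (tuples (suc d) (suc n)) f ≡
                 sum (tuples d n) (λ α → f (1⁺ Vec.∷ α)) ℚ.+ sum (tuples (suc d) n) (f ∘ incrementHead)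
sum-tuples-suc d n f = trans (sum-tuples d (suc n) f)
  (trans (sum-upTo-suc n (λ i → sum (tuples d (n ∸ i)) (λ α → f (pos⁺ (suc i) Vec.∷ α))))
    (cong (sum (tuples d n) (λ α → f (1⁺ Vec.∷ α)) ℚ.+_) (sym (sum-tuples d n (f ∘ incrementHead)))))

tupleWord-1∷ : ∀ {d} (α : Vec ℕ⁺ (suc d)) f →
               tupleWord (1⁺ Vec.∷ α) f ≡ integrate x₁ (tupleWord α f)
tupleWord-1∷ (_ Vec.∷ _) f = refl

tupleWord-incrementHead : ∀ {d} (α : Vec ℕ⁺ (suc d)) f →
                          tupleWord (incrementHead α) f ≡ integrate x₀ (tupleWord α f)
tupleWord-incrementHead (pos⁺ (suc s) Vec.∷ Vec.[])    f = refl
tupleWord-incrementHead (pos⁺ (suc s) Vec.∷ _ Vec.∷ _) f = refl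

tupleWords : ℕ → ℕ → Seq → Seq
tupleWords d n f i = sum (tuples (suc d) n) (λ α → tupleWord α f i)

sum-incrementHead : ∀ d n f i → sum (tuples (suc d) n) (λ α → tupleWord (incrementHead α) f i) ≡
                                integrate x₀ (tupleWords d n f) i
sum-incrementHead d n f i = trans
  (sum-cong (tuples (suc d) n) (λ α → cong (λ g → g i) (tupleWord-incrementHead α f)))
  (sym (homo-sum (linear-integrate x₀) (tuples (suc d) n) (λ α → tupleWord α f) i))

tupleWords-0-1 : ∀ f → tupleWords 0 1 f ≗ f
tupleWords-0-1 f i = ℚ.+-identityʳ (f i)

tupleWords-0-suc : ∀ n f → tupleWords 0 (suc (suc n)) f ≗ integrate x₀ (tupleWords 0 (suc n) f)
tupleWords-0-suc n f i = trans (sum-tuples-suc 0 (suc n) (λ α → tupleWord α f i))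
  (trans (ℚ.+-identityˡ _) (sum-incrementHead 0 (suc n) f i))

tupleWords-suc-suc : ∀ d n f → tupleWords (suc d) (suc n) f ≗
                     integrate x₁ (tupleWords d n f) ⊕ integrate x₀ (tupleWords (suc d) n f)
tupleWords-suc-suc d n f i = trans (sum-tuples-suc (suc d) n (λ α → tupleWord α f i))
  (cong₂ ℚ._+_
    (trans (sum-cong (tuples (suc d) n) (λ α → cong (λ g → g i) (tupleWord-1∷ α f)))
           (sym (homo-sum (linear-integrate x₁) (tuples (suc d) n) (λ α → tupleWord α f) i)))
    (sum-incrementHead (suc d) n f i))

tupleWords-𝟘 : ∀ d n f → n ℕ.≤ d → tupleWords d n f ≗ 𝟘
tupleWords-𝟘 d       zero    f _           i = refl
tupleWords-𝟘 (suc d) (suc n) f (ℕ.s≤s n≤d) i = trans (tupleWords-suc-suc d n f i)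
  (cong₂ ℚ._+_
    (trans (linear-integrate x₁ .resp-≗ (tupleWords-𝟘 d n f n≤d) i) (homo-𝟘 (linear-integrate x₁) i))
    (trans (linear-integrate x₀ .resp-≗ (tupleWords-𝟘 (suc d) n f (ℕ.m≤n⇒m≤1+n n≤d)) i)
           (homo-𝟘 (linear-integrate x₀) i)))

-- Both sides obey the same recursion on the first letter: it is x₁ if the first entry is 1, and x₀
-- if that entry is larger.
tupleWords≗words : ∀ a d f → tupleWords d (suc (a + d)) f ≗ words a d f
tupleWords≗words zero    zero    f i = tupleWords-0-1 f i
tupleWords≗words (suc a) zero    f i = trans (tupleWords-0-suc (a + 0) f i)
  (linear-integrate x₀ .resp-≗ (tupleWords≗words a 0 f) i)
tupleWords≗words zero    (suc d) f i = trans (tupleWords-suc-suc d (suc d) f i)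
  (trans (cong₂ ℚ._+_
           (linear-integrate x₁ .resp-≗ (tupleWords≗words zero d f) i)
           -- Here all entries must equal 1, so the x₀ branch is a sum over no tuples.
           (trans (linear-integrate x₀ .resp-≗ (tupleWords-𝟘 (suc d) (suc d) f ℕ.≤-refl) i)
                  (homo-𝟘 (linear-integrate x₀) i)))
         (ℚ.+-identityʳ _))
tupleWords≗words (suc a) (suc d) f i = trans (tupleWords-suc-suc d (suc (a + suc d)) f i)
  (trans (cong₂ ℚ._+_
           (trans (cong (λ l → integrate x₁ (tupleWords d (suc l) f) i) (ℕ.+-suc a d))
                  (linear-integrate x₁ .resp-≗ (tupleWords≗words (suc a) d f) i))
           (linear-integrate x₀ .resp-≗ (tupleWords≗words a (suc d) f) i))
         (ℚ.+-comm (integrate x₁ (words (suc a) d f) i) (integrate x₀ (words a (suc d) f) i)))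

-- Limits

diag-shiftʳ-≤ : ∀ m n (g : ℕ → ℕ → ℚ) → (∀ a b → 0ℚ ≤ g a b) →
                diag (λ a b → g a (n + b)) m ≤ diag g (n + m)
diag-shiftʳ-≤ m zero    g 0≤g = ℚ.≤-refl
diag-shiftʳ-≤ m (suc n) g 0≤g = ℚ.≤-trans
  (diag-shiftʳ-≤ m n (λ a b → g a (suc b)) (λ a b → 0≤g a (suc b)))
  (subst (diag (λ a b → g a (suc b)) (n + m) ≤_) (sym (diag-sucʳ (n + m) g))
    (p≤p+q (diag (λ a b → g a (suc b)) (n + m)) (0≤g (suc (n + m)) 0)))

module _ (u v : List ℕ⁺) where

  -- The sum of `coeff u a` times `coeff v b` over the triangle a + b ≤ N.
  triangle : Seq
  triangle N = below (conv (coeff u) (coeff v)) (suc N)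

  triangle≡diag : ∀ N → triangle N ≡ diag (λ a b → coeff u a ℚ.* H v b) N
  triangle≡diag N = begin
    triangle N
      ≡⟨ conv-derivativeʳ x₁ (coeff u) (coeff v) (suc N) ⟨
    conv (coeff u) (below (coeff v)) (suc N)
      ≡⟨ diag-sucʳ N (λ a b → coeff u a ℚ.* below (coeff v) b) ⟩
    diag (λ a b → coeff u a ℚ.* below (coeff v) (suc b)) N ℚ.+ coeff u (suc N) ℚ.* 0ℚ
      ≡⟨ cong₂ ℚ._+_ (diag-cong N (λ a b → cong (coeff u a ℚ.*_) (below-coeff v b)))
                     (ℚ.*-zeroʳ (coeff u (suc N))) ⟩
    diag (λ a b → coeff u a ℚ.* H v b) N ℚ.+ 0ℚ
      ≡⟨ ℚ.+-identityʳ _ ⟩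
    diag (λ a b → coeff u a ℚ.* H v b) N ∎

  diag-coeff : ∀ N r → diag (λ a _ → coeff u a ℚ.* r) N ≡ H u N ℚ.* r
  diag-coeff N r = begin
    diag (λ a _ → coeff u a ℚ.* r) N    ≡⟨ diag-cong N (λ a _ → ℚ.*-comm (coeff u a) r) ⟩
    diag (λ a _ → r ℚ.* coeff u a) N    ≡⟨ diag-*ˡ N r (λ a _ → coeff u a) ⟩
    r ℚ.* diag (λ a _ → coeff u a) N    ≡⟨ ℚ.*-comm r _ ⟩
    diag (λ a _ → coeff u a) N ℚ.* r    ≡⟨ cong (ℚ._* r) (trans (below-diag N (coeff u)) (below-coeff u N)) ⟩
    H u N ℚ.* r                         ∎

  coeff*H-mono : ∀ a {b c} → b ℕ.≤ c → coeff u a ℚ.* H v b ≤ coeff u a ℚ.* H v c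
  coeff*H-mono a b≤c =
    ℚ.*-monoˡ-≤-nonNeg (coeff u a) {{ℚ.nonNegative (0≤coeff u a)}} (H-mono v b≤c)

  triangle-upper : ∀ N → triangle N ≤ H u N ℚ.* H v N
  triangle-upper N = subst₂ _≤_ (sym (triangle≡diag N)) (diag-coeff N (H v N))
    (diag-mono₊-≤ N (λ a b a+b≡N → coeff*H-mono a (subst (b ℕ.≤_) a+b≡N (ℕ.m≤n+m b a))))

  -- Keep only the columns a ≤ M of the triangle: each has height at least M′, hence at least M.
  triangle-lower : ∀ {M M′} → M ℕ.≤ M′ → H u M ℚ.* H v M ≤ triangle (M′ + M)
  triangle-lower {M} {M′} M≤M′ =
    subst₂ _≤_ (diag-coeff M (H v M)) (sym (triangle≡diag (M′ + M))) (ℚ.≤-trans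
      (diag-mono₊-≤ M (λ a b _ → coeff*H-mono a (ℕ.m≤n⇒m≤n+o b M≤M′)))
      (diag-shiftʳ-≤ M M′ (λ a b → coeff u a ℚ.* H v b) (λ a b → 0≤* (0≤coeff u a) (0≤H v b))))

  -- triangle N is squeezed between the products of the sums truncated at
  -- ⌊N/2⌋ and at N.
  ≈-triangle : ∀ x y → (∀ N → seq x N ≡ H u N ℚ.* H v N) → (∀ N → seq y N ≡ triangle N) → x ≈ y
  -- For N ≥ K + K the square of side K fits into the triangle of size N. Both values then lie
  -- between `seq x K` and `seq x N`, which differ by less than ε.
  ≈-triangle x y x≡ y≡ ε 0<ε with K , h ← cauchy x ε 0<ε = K + K , close
    where
    close : ∀ N → K + K ℕ.≤ N → ∣ seq x N ℚ.- seq y N ∣ ℚ.< ε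
    close N K+K≤N = ℚ.≤-<-trans
      (∣-∣-interval {seq x K} xK≤xN (ℚ.≤-reflexive top) xK≤yN (ℚ.≤-trans yN≤xN (ℚ.≤-reflexive top)))
      (ℚ.≤-<-trans (ℚ.≤-reflexive (sym (ℚ.0≤p⇒∣p∣≡p 0≤xN-xK))) (h N K K≤N ℕ.≤-refl))
      where
      K≤N : K ℕ.≤ N
      K≤N = ℕ.m+n≤o⇒m≤o K K+K≤N
      K≤N∸K : K ℕ.≤ N ∸ K
      K≤N∸K = subst (ℕ._≤ N ∸ K) (ℕ.m+n∸n≡m K K) (ℕ.∸-monoˡ-≤ K K+K≤N)
      top : seq x N ≡ seq x K ℚ.+ (seq x N ℚ.- seq x K)
      top = solve 2 (λ a b → a := b :+ (a :- b)) refl (seq x N) (seq x K)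
      xK≤yN : seq x K ≤ seq y N
      xK≤yN = subst₂ _≤_ (sym (x≡ K))
        (trans (cong triangle (ℕ.m∸n+n≡m K≤N)) (sym (y≡ N))) (triangle-lower K≤N∸K)
      yN≤xN : seq y N ≤ seq x N
      yN≤xN = subst₂ _≤_ (sym (y≡ N)) (sym (x≡ N)) (triangle-upper N)
      xK≤xN : seq x K ≤ seq x N
      xK≤xN = ℚ.≤-trans xK≤yN yN≤xN
      0≤xN-xK : 0ℚ ≤ seq x N ℚ.- seq x K
      0≤xN-xK = subst (_≤ seq x N ℚ.- seq x K) (ℚ.+-inverseʳ (seq x K)) (ℚ.+-monoˡ-≤ (ℚ.- seq x K) xK≤xN)

-- Truncations of the two sums

truncate : ℕ → ℕ → Seq → Seq
truncate c e f = ι c ⊙ below (integrate^ x₀ e f)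

linear-truncate : ∀ c e → Linear (truncate c e)
linear-truncate c e = linear-∘ (linear-⊙ (ι c)) (linear-∘ linear-below (linear-integrate^ x₀ e))

below-latticeTerm : ∀ a m n₁ n₂ →
                    truncate ((m + n₁) C m) (suc (m + n₁)) (a n₂) ≗ below (latticeTerm a m n₁ n₂)
below-latticeTerm a m n₁ n₂ i =
  sym (linear-below .homo-⊙ (ι ((m + n₁) C m)) (integrate^ x₀ (suc (m + n₁)) (a n₂)) i)

-- A record rather than a function type, so that x can be inferred from it.
record Represents (x : ℝ) (f : Seq) : Set where
  constructor represents
  field
    seq≡ : ∀ N → seq x N ≡ f N

open Represents

ζ-represents : ∀ s .{{_ : NonTrivial s}} ss → Represents (ζ s ss) (H (pos⁺ s {{ℕ.nonTrivial⇒nonZero s}} ∷ ss))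
ζ-represents s ss .seq≡ N = refl

-- The bound x < n is handed on for the second sum: t < k makes the tail of β nonempty, so that
-- `incrementLast` has an entry to raise.
represents-∑³ : ∀ n {B : Set} {C : ℕ → B → Set} (ys : List B) (zs : ∀ x y → List (C x y))
                (f : ∀ x y → C x y → ℝ) (g : ∀ x y → C x y → Seq) →
                (∀ x → x ℕ.< n → ∀ y z → Represents (f x y z) (g x y z)) →
                Represents (∑ (upTo n) λ x → ∑ ys λ y → ∑ (zs x y) (f x y))
                           (λ N → sum (upTo n) λ x → sum ys λ y → sum (zs x y) (λ z → g x y z N))
represents-∑³ n ys zs f g f≡g .seq≡ N =
  trans (seq-∑ (upTo n) (λ x → ∑ ys λ y → ∑ (zs x y) (f x y)) N)
    (sum-upTo-cong n (λ x x<n → trans (seq-∑ ys (λ y → ∑ (zs x y) (f x y)) N)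
      (sum-cong ys (λ y → trans (seq-∑ (zs x y) (f x y) N)
        (sum-cong (zs x y) (λ z → f≡g x x<n y z .seq≡ N))))))

seq-*ζ : ∀ c e s .{{_ : NonTrivial s}} s′ ss {f} N → s ≡ val s′ + e → coeff (s′ ∷ ss) ≗ f →
         seq (fromℕ c *ℝ ζ s ss) N ≡ truncate c e f (suc N)
seq-*ζ c e s s′ ss {f} N eq coeff≗f = cong₂ ℚ._*_ (ι≡ c) (begin
  H (s⁺ ∷ ss) N                    ≡⟨ below-coeff (s⁺ ∷ ss) N ⟨
  below (coeff (s⁺ ∷ ss)) (suc N)
    ≡⟨ linear-below .resp-≗ (λ i → trans (coeff-raise e s′ s⁺ ss eq i)
                                          (linear-integrate^ x₀ e .resp-≗ coeff≗f i)) (suc N) ⟩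
  below (integrate^ x₀ e f) (suc N) ∎)
  where
  s⁺ : ℕ⁺
  s⁺ = pos⁺ s {{ℕ.nonTrivial⇒nonZero s}}

-- The binomial x stays outside as a path count, while y moves onto the closing word, where
-- `conv-x₁^` turns it back into a shuffle.
sum-tuples-truncate : ∀ d a e x y f i →
  sum (tuples (suc d) (a + d + 1)) (λ α → truncate (x * y) e (tupleWord α f) i) ≡
  truncate x e (words a d (ι y ⊙ f)) i
sum-tuples-truncate d a e x y f i = begin
  sum (tuples (suc d) (a + d + 1)) (λ α → truncate (x * y) e (tupleWord α f) i)
    ≡⟨ homo-sum (linear-truncate (x * y) e) (tuples (suc d) (a + d + 1)) (λ α → tupleWord α f) i ⟨
  truncate (x * y) e (tupleWords d (a + d + 1) f) i
    ≡⟨ cong (λ l → truncate (x * y) e (tupleWords d l f) i) (ℕ.+-comm (a + d) 1) ⟩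
  truncate (x * y) e (tupleWords d (suc (a + d)) f) i
    ≡⟨ linear-truncate (x * y) e .resp-≗ (tupleWords≗words a d f) i ⟩
  ι (x * y) ℚ.* below (integrate^ x₀ e w) i
    ≡⟨ trans (cong (ℚ._* below (integrate^ x₀ e w) i) (ι-* x y)) (ℚ.*-assoc (ι x) (ι y) _) ⟩
  ι x ℚ.* (ι y ℚ.* below (integrate^ x₀ e w) i)
    ≡⟨ cong (ι x ℚ.*_) (linear-∘ linear-below (linear-integrate^ x₀ e) .homo-⊙ (ι y) w i) ⟨
  truncate x e (ι y ⊙ w) i
    ≡⟨ linear-truncate x e .resp-≗ (linear-words a d .homo-⊙ (ι y) f) i ⟨
  truncate x e (words a d (ι y ⊙ f)) i ∎
  where w = words a d f

module _ (m n j k : ℕ) where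

  private
    I₀ = integrate x₀
    I₁ = integrate x₁

  termˡ : ∀ n₁ j₁ j₂ → Vec ℕ⁺ (suc j₁) → Seq
  termˡ n₁ j₁ j₂ α N =
    truncate (((m + n₁) C m) * ((k + j₂) C k)) (suc (m + n₁)) (tupleWord α (I₁ (word 0 (k + j₂)))) (suc N)

  termʳ : ∀ t k₁ m₁ → Vec ℕ⁺ (suc k₁) → Seq
  termʳ t k₁ m₁ β N =
    truncate (((n + m₁) C n) * ((suc j + t) C suc j)) (suc (n + m₁))
      (tupleWord β (I₀ (word 0 (suc j + t)))) (suc N)

  represents-termˡ : .{{m≢0 : NonZero (suc m)}} → ∀ n₁ j₁ j₂ (α : Vec ℕ⁺ (suc j₁)) → Represents
    (fromℕ (((suc m ∸ 1 + n₁) C (suc m ∸ 1)) * ((j₂ + suc k ∸ 1) C (suc k ∸ 1))) *ℝ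
     ζ (val (head α) + suc m + n₁) {{p+m+n-nonTrivialᵐ (head α) (suc m) n₁ {{m≢0}}}}
       (toList (tail α) ++ replicate (j₂ + suc k ∸ 1) 1⁺))
    (termˡ n₁ j₁ j₂ α)
  represents-termˡ {{m≢0}} n₁ j₁ j₂ α@(s Vec.∷ ss) .seq≡ N
    -- The order k + j₂ gives the binomial the form in which `conv-x₁^ k j₂` produces it.
    rewrite trans (cong (_∸ 1) (ℕ.+-suc j₂ k)) (ℕ.+-comm j₂ k) =
    seq-*ζ _ (suc (m + n₁)) (val s + suc m + n₁) {{p+m+n-nonTrivialᵐ s (suc m) n₁ {{m≢0}}}} s
      (toList ss ++ replicate (k + j₂) 1⁺) N (ℕ.+-assoc (val s) (suc m) n₁)
      (λ i → trans (coeff-tupleWord α (replicate (k + j₂) 1⁺) i)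
        (linear-tupleWord α .resp-≗ (linear-integrate x₁ .resp-≗ (coeff-replicate (k + j₂))) i))

  represents-termʳ : .{{n≢0 : NonZero (suc n)}} → ∀ t k₁ → .{{NonZero k₁}} → ∀ m₁ (β : Vec ℕ⁺ (suc k₁)) → Represents
    (fromℕ (((m₁ + suc n ∸ 1) C (suc n ∸ 1)) * ((suc j + t) C suc j)) *ℝ
     ζ (val (head β) + m₁ + suc n) {{p+m+n-nonTrivialⁿ (head β) m₁ (suc n) {{n≢0}}}}
       (toList (incrementLast (tail β)) ++ replicate (suc j + t ∸ 1) 1⁺))
    (termʳ t k₁ m₁ β)
  represents-termʳ {{n≢0}} t (suc k₁) m₁ β@(s Vec.∷ ss@(_ Vec.∷ _)) .seq≡ N
    rewrite trans (cong (_∸ 1) (ℕ.+-suc m₁ n)) (ℕ.+-comm m₁ n) =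
    seq-*ζ _ (suc (n + m₁)) (val s + m₁ + suc n) {{p+m+n-nonTrivialⁿ s m₁ (suc n) {{n≢0}}}} s
      (toList (incrementLast ss) ++ replicate (j + t) 1⁺) N
      (trans (ℕ.+-assoc (val s) m₁ (suc n)) (cong (val s +_) (ℕ.+-comm m₁ (suc n))))
      (λ i → trans (coeff-incrementLast β (replicate (j + t) 1⁺) i)
        (linear-∘ (linear-tupleWord β) (linear-∘ (linear-integrate x₀) (linear-integrate x₁))
          .resp-≗ (coeff-replicate (j + t)) i))

module _ (m n j k N : ℕ) where

  private
    I₀ = integrate x₀
    I₁ = integrate x₁

  sumˡ : ℕ → ℕ → ℕ → ℕ → ℚ
  sumˡ n₁ n₂ j₁ j₂ = sum (tuples (suc j₁) (n₂ + j₁ + 1)) (λ α → termˡ m n j k n₁ j₁ j₂ α N)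

  sumʳ : ℕ → ℕ → ℕ → ℕ → ℚ
  sumʳ t k₁ m₁ m₂ = sum (tuples (suc k₁) (m₂ + k₁ + 1)) (λ β → termʳ m n j k t k₁ m₁ β N)

  sumˡ≡ : ∀ n₁ n₂ j₁ j₂ → sumˡ n₁ n₂ j₁ j₂ ≡
    truncate ((m + n₁) C m) (suc (m + n₁)) (words n₂ j₁ (I₁ (conv (word 0 j₂) (word 0 k)))) (suc N)
  sumˡ≡ n₁ n₂ j₁ j₂ = begin
    sumˡ n₁ n₂ j₁ j₂
      ≡⟨ sum-tuples-truncate j₁ n₂ (suc (m + n₁)) ((m + n₁) C m) c (I₁ (word 0 (k + j₂))) (suc N) ⟩
    truncate ((m + n₁) C m) (suc (m + n₁)) (words n₂ j₁ (ι c ⊙ I₁ (word 0 (k + j₂)))) (suc N)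
      ≡⟨ linear-∘ (linear-truncate ((m + n₁) C m) (suc (m + n₁))) (linear-words n₂ j₁) .resp-≗ (λ i → trans
           (sym (linear-integrate x₁ .homo-⊙ (ι c) (word 0 (k + j₂)) i))
           (linear-integrate x₁ .resp-≗ (λ i → trans (sym (conv-x₁^ k j₂ i))
             (conv-comm (word 0 k) (word 0 j₂) i)) i)) (suc N) ⟩
    truncate ((m + n₁) C m) (suc (m + n₁)) (words n₂ j₁ (I₁ (conv (word 0 j₂) (word 0 k)))) (suc N) ∎
    where c = (k + j₂) C k

  diag-sumˡ : ∀ n₁ n₂ → diag (sumˡ n₁ n₂) (suc j) ≡ below (latticeTerm (afterX₀ˡ j k) m n₁ n₂) (suc N)
  diag-sumˡ n₁ n₂ = begin
    diag (sumˡ n₁ n₂) (suc j)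
      ≡⟨ diag-cong (suc j) (sumˡ≡ n₁ n₂) ⟩
    diag (λ j₁ j₂ → truncate c (suc (m + n₁)) (w j₁ j₂) (suc N)) (suc j)
      ≡⟨ homo-diag (linear-truncate c (suc (m + n₁))) (suc j) w (suc N) ⟨
    truncate c (suc (m + n₁)) (afterX₀ˡ j k n₂) (suc N)
      ≡⟨ below-latticeTerm (afterX₀ˡ j k) m n₁ n₂ (suc N) ⟩
    below (latticeTerm (afterX₀ˡ j k) m n₁ n₂) (suc N) ∎
    where
    c = (m + n₁) C m
    w : ℕ → ℕ → Seq
    w j₁ j₂ = words n₂ j₁ (I₁ (conv (word 0 j₂) (word 0 k)))

  sumsˡ : sum (upTo (suc (suc n))) (λ n₁ → sum (antidiagonal (suc j)) (λ (j₁ , j₂) → sumˡ n₁ (suc n ∸ n₁) j₁ j₂)) ≡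
          below (lattice (afterX₀ˡ j k) (suc m) (suc n)) (suc N)
  sumsˡ = begin
    sum (upTo (suc (suc n))) (λ n₁ → sum (antidiagonal (suc j)) (λ (j₁ , j₂) → sumˡ n₁ (suc n ∸ n₁) j₁ j₂))
      ≡⟨ sum-cong (upTo (suc (suc n)))
           (λ n₁ → sum-antidiagonal (suc j) (λ (j₁ , j₂) → sumˡ n₁ (suc n ∸ n₁) j₁ j₂)) ⟩
    sum (upTo (suc (suc n))) (λ n₁ → diag (sumˡ n₁ (suc n ∸ n₁)) (suc j))
      ≡⟨ sum-upTo-diag (suc n) (λ n₁ n₂ → diag (sumˡ n₁ n₂) (suc j)) ⟩
    diag (λ n₁ n₂ → diag (sumˡ n₁ n₂) (suc j)) (suc n)
      ≡⟨ diag-cong (suc n) diag-sumˡ ⟩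
    diag (λ n₁ n₂ → below (latticeTerm (afterX₀ˡ j k) m n₁ n₂) (suc N)) (suc n)
      ≡⟨ homo-diag linear-below (suc n) (latticeTerm (afterX₀ˡ j k) m) (suc N) ⟨
    below (lattice (afterX₀ˡ j k) (suc m) (suc n)) (suc N) ∎

  sumʳ≡ : ∀ t k₁ m₁ m₂ → sumʳ t (suc k₁) m₁ m₂ ≡
    truncate ((n + m₁) C n) (suc (n + m₁))
      (words m₂ (suc k₁) (I₀ (conv (word 0 (suc j)) (word 0 t)))) (suc N)
  sumʳ≡ t k₁ m₁ m₂ = begin
    sumʳ t (suc k₁) m₁ m₂
      ≡⟨ sum-tuples-truncate (suc k₁) m₂ (suc (n + m₁)) ((n + m₁) C n) c (I₀ (word 0 (suc j + t))) (suc N) ⟩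
    truncate ((n + m₁) C n) (suc (n + m₁)) (words m₂ (suc k₁) (ι c ⊙ I₀ (word 0 (suc j + t)))) (suc N)
      ≡⟨ linear-∘ (linear-truncate ((n + m₁) C n) (suc (n + m₁))) (linear-words m₂ (suc k₁)) .resp-≗
           (λ i → trans (sym (linear-integrate x₀ .homo-⊙ (ι c) (word 0 (suc j + t)) i))
             (sym (linear-integrate x₀ .resp-≗ (conv-x₁^ (suc j) t) i))) (suc N) ⟩
    truncate ((n + m₁) C n) (suc (n + m₁))
      (words m₂ (suc k₁) (I₀ (conv (word 0 (suc j)) (word 0 t)))) (suc N) ∎
    where c = (suc j + t) C suc j

  diag-sumʳ : ∀ m₁ m₂ → diag (λ t k₁ → sumʳ t (suc k₁) m₁ m₂) k ≡
                        below (latticeTerm (afterX₀ʳ j k) n m₁ m₂) (suc N)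
  diag-sumʳ m₁ m₂ = begin
    diag (λ t k₁ → sumʳ t (suc k₁) m₁ m₂) k
      ≡⟨ diag-cong k (λ t k₁ → sumʳ≡ t k₁ m₁ m₂) ⟩
    diag (λ t k₁ → truncate c (suc (n + m₁)) (w t k₁) (suc N)) k
      ≡⟨ homo-diag (linear-truncate c (suc (n + m₁))) k w (suc N) ⟨
    truncate c (suc (n + m₁)) (afterX₀ʳ j k m₂) (suc N)
      ≡⟨ below-latticeTerm (afterX₀ʳ j k) n m₁ m₂ (suc N) ⟩
    below (latticeTerm (afterX₀ʳ j k) n m₁ m₂) (suc N) ∎
    where
    c = (n + m₁) C n
    w : ℕ → ℕ → Seq
    w t k₁ = words m₂ (suc k₁) (I₀ (conv (word 0 (suc j)) (word 0 t)))

  sumsʳ : sum (upTo (suc k)) (λ t → sum (antidiagonal m) (λ (m₁ , m₂) → sumʳ t (suc k ∸ t) m₁ m₂)) ≡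
          below (lattice (afterX₀ʳ j k) (suc n) m) (suc N)
  sumsʳ = begin
    sum (upTo (suc k)) (λ t → sum (antidiagonal m) (λ (m₁ , m₂) → sumʳ t (suc k ∸ t) m₁ m₂))
      ≡⟨ sum-cong (upTo (suc k))
           (λ t → sum-antidiagonal m (λ (m₁ , m₂) → sumʳ t (suc k ∸ t) m₁ m₂)) ⟩
    sum (upTo (suc k)) (λ t → diag (sumʳ t (suc k ∸ t)) m)
      ≡⟨ sum-upTo-diag-suc k (λ t k₁ → diag (sumʳ t k₁) m) ⟩
    diag (λ t k₁ → diag (sumʳ t (suc k₁)) m) k
      -- The theorem sums over t outermost, but `lattice` sums over the path lengths first.
      ≡⟨ diag-swap k m (λ t k₁ → sumʳ t (suc k₁)) ⟩
    diag (λ m₁ m₂ → diag (λ t k₁ → sumʳ t (suc k₁) m₁ m₂) k) m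
      ≡⟨ diag-cong m diag-sumʳ ⟩
    diag (λ m₁ m₂ → below (latticeTerm (afterX₀ʳ j k) n m₁ m₂) (suc N)) m
      ≡⟨ homo-diag linear-below m (latticeTerm (afterX₀ʳ j k) n) (suc N) ⟨
    below (lattice (afterX₀ʳ j k) (suc n) m) (suc N) ∎

-- The identity between zeta values

coeff-word : ∀ m j → coeff (pos⁺ (suc m + 1) ∷ replicate j 1⁺) ≗ word (suc m) (suc j)
coeff-word m j i = trans (coeff-∷ (m + 1) (replicate j 1⁺) i)
  (trans (cong (λ l → integrate^ x₀ l (integrate x₁ (coeff (replicate j 1⁺))) i) (ℕ.+-comm m 1))
    (linear-∘ (linear-integrate^ x₀ (suc m)) (linear-integrate x₁) .resp-≗ (coeff-replicate j) i))

*ℝ-+ℝ-≈ : ∀ u v {x y z w f g} → Represents x (H u) → Represents y (H v) → Represents z f → Represents w g →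
          f ⊕ g ≗ triangle u v → x *ℝ y ≈ z +ℝ w
*ℝ-+ℝ-≈ u v {x} {y} {z} {w} x≡ y≡ z≡ w≡ eq = ≈-triangle u v (x *ℝ y) (z +ℝ w)
  (λ N → cong₂ ℚ._*_ (x≡ .seq≡ N) (y≡ .seq≡ N))
  (λ N → trans (cong₂ ℚ._+_ (z≡ .seq≡ N) (w≡ .seq≡ N)) (eq N))

module _ (m n j k : ℕ) where

  private
    u v : List ℕ⁺
    u = pos⁺ (suc m + 1) ∷ replicate j 1⁺
    v = pos⁺ (suc n + 1) ∷ replicate k 1⁺

    sˡ sʳ : Seq
    sˡ = lattice (afterX₀ˡ j k) (suc m) (suc n)
    sʳ = lattice (afterX₀ʳ j k) (suc n) m

  sums≗triangle : (below sˡ ∘ suc) ⊕ (below sʳ ∘ suc) ≗ triangle u v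
  sums≗triangle N = begin
    below sˡ (suc N) ℚ.+ below sʳ (suc N)   ≡⟨ linear-below .homo-⊕ sˡ sʳ (suc N) ⟨
    below (sˡ ⊕ sʳ) (suc N)
      ≡⟨ linear-below .resp-≗ (λ i → trans (conv-cong (coeff-word m j) (coeff-word n k) i)
                                            (conv-words j k m n i)) (suc N) ⟨
    triangle u v N                          ∎

  represents-∑ˡ : (f : ℕ → (p : ℕ × ℕ) → Vec ℕ⁺ (suc (proj₁ p)) → ℝ) →
    (∀ n₁ p α → Represents (f n₁ p α) (termˡ m n j k n₁ (proj₁ p) (proj₂ p) α)) →
    Represents
      (∑ (upTo (suc (suc n))) λ n₁ → ∑ (antidiagonal (suc j)) λ p →
       ∑ (tuples (suc (proj₁ p)) (suc n ∸ n₁ + proj₁ p + 1)) (f n₁ p))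
      (below sˡ ∘ suc)
  represents-∑ˡ f f≡ .seq≡ N = trans
    (represents-∑³ (suc (suc n)) (antidiagonal (suc j))
      (λ n₁ p → tuples (suc (proj₁ p)) (suc n ∸ n₁ + proj₁ p + 1))
      f (λ n₁ p → termˡ m n j k n₁ (proj₁ p) (proj₂ p)) (λ n₁ _ → f≡ n₁) .seq≡ N)
    (sumsˡ m n j k N)

  represents-∑ʳ : (g : (t : ℕ) → ℕ × ℕ → Vec ℕ⁺ (suc (suc k ∸ t)) → ℝ) →
    (∀ t → .{{NonZero (suc k ∸ t)}} → ∀ p β → Represents (g t p β) (termʳ m n j k t (suc k ∸ t) (proj₁ p) β)) →
    Represents
      (∑ (upTo (suc k)) λ t → ∑ (antidiagonal (suc m ∸ 1)) λ p →
       ∑ (tuples (suc (suc k ∸ t)) (proj₂ p + (suc k ∸ t) + 1)) (g t p))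
      (below sʳ ∘ suc)
  represents-∑ʳ g g≡ .seq≡ N = trans
    (represents-∑³ (suc k) (antidiagonal m)
      (λ t p → tuples (suc (suc k ∸ t)) (proj₂ p + (suc k ∸ t) + 1))
      g (λ t p → termʳ m n j k t (suc k ∸ t) (proj₁ p))
      (λ t t<1+k → g≡ t {{ℕ.>-nonZero (ℕ.m<n⇒0<n∸m t<1+k)}}) .seq≡ N)
    (sumsʳ m n j k N)

theorem1p1 : ∀ (m n j k : ℕ) .{{_ : NonZero m}} .{{_ : NonZero n}} .{{_ : NonZero j}} .{{_ : NonZero k}} →
  ζ (m + 1) {{m+1-nonTrivial m}} (replicate (j ∸ 1) 1⁺) *ℝ
  ζ (n + 1) {{m+1-nonTrivial n}} (replicate (k ∸ 1) 1⁺)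
  ≈
  (∑ (upTo (suc n)) λ n₁ →
   ∑ (antidiagonal j) λ (j₁ , j₂) →
   ∑ (tuples (suc j₁) (n ∸ n₁ + j₁ + 1)) λ α →
     fromℕ (((m ∸ 1 + n₁) C (m ∸ 1)) * ((j₂ + k ∸ 1) C (k ∸ 1))) *ℝ
     ζ (val (head α) + m + n₁) {{p+m+n-nonTrivialᵐ (head α) m n₁}}
       (toList (Vec.tail α) ++ replicate (j₂ + k ∸ 1) 1⁺))
  +ℝ
  (∑ (upTo k) λ t →
   ∑ (antidiagonal (m ∸ 1)) λ (m₁ , m₂) →
   ∑ (tuples (suc (k ∸ t)) (m₂ + (k ∸ t) + 1)) λ β →
     fromℕ (((m₁ + n ∸ 1) C (n ∸ 1)) * ((j + t) C j)) *ℝ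
     ζ (val (head β) + m₁ + n) {{p+m+n-nonTrivialⁿ (head β) m₁ n}}
       (toList (incrementLast (Vec.tail β)) ++ replicate (j + t ∸ 1) 1⁺))
theorem1p1 (suc m) (suc n) (suc j) (suc k) {{m≢0}} {{n≢0}} = result
  where
  -- Inferred before being compared with the goal, and with the same instances
  -- as there: otherwise both sides get unfolded down to gcd computations.
  result = *ℝ-+ℝ-≈ (pos⁺ (suc m + 1) ∷ replicate j 1⁺) (pos⁺ (suc n + 1) ∷ replicate k 1⁺)
    (ζ-represents (suc m + 1) {{m+1-nonTrivial (suc m) {{m≢0}}}} (replicate (suc j ∸ 1) 1⁺))
    (ζ-represents (suc n + 1) {{m+1-nonTrivial (suc n) {{n≢0}}}} (replicate (suc k ∸ 1) 1⁺))
    (represents-∑ˡ m n j k _ (λ n₁ p α → represents-termˡ m n j k {{m≢0}} n₁ (proj₁ p) (proj₂ p) α))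
    (represents-∑ʳ m n j k _ (λ t p β → represents-termʳ m n j k {{n≢0}} t (suc k ∸ t) (proj₁ p) β))
    (sums≗triangle m n j k)
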